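{- Let $n\ge 1$, let $\lambda\in Par_{\le 2n}$, $\mu\in Par_{\le n}$ with $\mu\subseteq\lambda$, and let $T\in LRS_{2n}(\lambda/\mu)$ have weight $\nu$ (an even partition), with conjugate partition $\nu^t=(\nu^t_1,\dots,\nu^t_{\nu_1})$. Let $J_1,\dots,J_{\nu_1}$ be the decomposition of $D(\lambda/\mu)$ into vertical strips associated with $T$ (described in the context), so that $J_k$ has $\nu^t_k\in 2\mathbb{Z}$ cells, filled in $T$ from top to bottom with $1,2,\dots,\nu^t_k$. Let $Q=\lozenge T$ be the tableau of shape $\lambda/\mu$ obtained by relabelling every cell of $J_k$ with the entry $k$, for $k=1,\dots,\nu_1$. Then $Q\in\widetilde{Rec}_{2n}(\lambda/\mu)$, $Q$ has weight $(Q[1],Q[2],\dots)=\nu^t$, and the map $\lozenge:LRS_{2n}(\lambda/\mu)\to\widetilde{Rec}_{2n}(\lambda/\mu)$, $T\mapsto\lozenge T$, is a bijection.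
   Context: Partitions are identified with Young diagrams $D(\gamma)$ (cells $(i,j)$, $1\le i\le\ell(\gamma)$, $1\le j\le\gamma_i$); $Par_{\le m}$ is the set of partitions with at most $m$ nonzero parts. A partition $\gamma$ is even if $\gamma_{2i-1}=\gamma_{2i}$ for all $i\ge1$ (all columns have even length). $SST_{2n}(\lambda/\mu)$ is the set of semistandard tableaux of skew shape $\lambda/\mu$ with entries in $\{1,\dots,2n\}$ (rows weakly increasing, columns strictly increasing). For a tableau $U$, $U[k]$ is the number of entries equal to $k$. A word $u_1\cdots u_N$ is Yamanouchi if for every $k$ the weight of $u_1\cdots u_k$ is a partition. $LRS_{2n}(\lambda/\mu)$ (Littlewood–Richardson–Sundaram tableaux), for $\lambda\in Par_{\le2n}$, $\mu\in Par_{\le n}$: the set of $T\in SST_{2n}(\lambda/\mu)$ such that (i) the word obtained by reading the columns of $T$ from right to left, each column from top to bottom, is a Yamanouchi word; (ii) the weight $(T[1],\dots,T[2n])$ is an even partition; (iii) whenever $T(i,j)=2k+1$ with $k\in\mathbb{Z}_{\ge0}$, one has $i\le n+k$. Strip decomposition of $T\in LRS_{2n}(\lambda/\mu)$ of weight $\nu$: put $\mu^{(0)}=\lambda$; for $k=1,\dots,\nu_1$, let $J_k$ consist of, for each $i=1,\dots,\nu^t_k$, the rightmost cell of $D(\mu^{(k-1)}/\mu)$ whose entry in $T$ is $i$, and let $D(\mu^{(k)})=D(\mu^{(k-1)})\setminus J_k$. Then $\lambda=\mu^{(0)}\supseteq\mu^{(1)}\supseteq\cdots\supseteq\mu^{(\nu_1)}=\mu$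 with each $J_k=\mu^{(k-1)}/\mu^{(k)}$ a vertical strip. $\widetilde{Rec}_{2n}(\lambda/\mu)$, for $\lambda\in Par_{\le2n}$, $\mu\in Par_{\le n}$, $\mu\subseteq\lambda$: the set of fillings $Q$ of $D(\lambda/\mu)$ by positive integers such that (R1) entries strictly decrease along rows from left to right; (R2) entries weakly decrease down columns; (R3) $Q[k]$ is even for every $k>0$; (R4) for every $k>0$, $Q[k]\ge 2(\ell(\mu^{(k-1)})-n)$, where $D(\mu^{(k-1)})=D(\mu)\cup\{(i,j)\in D(\lambda/\mu):Q(i,j)\ge k\}$; (R5) for all $r,k>0$, $Q_{\le r}[k+1]\le Q_{\le r}[k]$, where $Q_{\le r}[k]$ is the number of entries $k$ of $Q$ in rows $1,\dots,r$. -}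

module Defs where

open import Data.Nat using (ℕ; zero; suc; _+_; _*_; _∸_; _⊔_; _≤_; _<_; _≤?_; _<?_; _≟_; _≤ᵇ_)
open import Data.Nat.Divisibility using (_∣_)
open import Data.Bool using (Bool; true; false; if_then_else_)
open import Data.Maybe using (Maybe; just; nothing)
open import Data.Product using (_×_; _,_; proj₁; proj₂)
open import Data.Product.Properties using (≡-dec)
open import Data.List using (List; []; _∷_; length; map; filter; upTo; downFrom; concatMap; catMaybes; take; foldr; any)
open import Data.List.Relation.Unary.All using (All)
open import Data.List.Relation.Unary.Linked using (Linked)
open import Relation.Nullary using (Dec; ¬?)
open import Relation.Nullary.Decidable using (_×-dec_; ⌊_⌋)
open import Relation.Binary.PropositionalEquality using (_≡_)

IsPartition : List ℕ → Set
IsPartition γ = All (λ x → 1 ≤ x) γ × Linked (λ a b → b ≤ a) γ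

at : List ℕ → ℕ → ℕ
at []       _       = 0
at (x ∷ xs) zero    = x
at (x ∷ xs) (suc i) = at xs i

-- 1-based part γ_i (γ_0 := 0, γ_i = 0 for i > ℓ(γ))
part : List ℕ → ℕ → ℕ
part γ zero    = 0
part γ (suc i) = at γ i

_⊆P_ : List ℕ → List ℕ → Set
mu ⊆P lam = ∀ i → part mu i ≤ part lam i

-- Skew diagrams. Cells are pairs (i , j), 1-based row i, column j.

Cell : Set
Cell = ℕ × ℕ

-- (i , j) ∈ D(λ/μ)  iff  μ_i < j ≤ λ_i   (this forces i ≥ 1, j ≥ 1)
InSkew : List ℕ → List ℕ → ℕ → ℕ → Set
InSkew lam mu i j = part mu i < j × j ≤ part lam i

inSkew? : (lam mu : List ℕ) (i j : ℕ) → Dec (InSkew lam mu i j)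
inSkew? lam mu i j = (part mu i <? j) ×-dec (j ≤? part lam i)

readCells : List ℕ → List ℕ → List Cell
readCells lam mu =
  concatMap (λ j → map (λ i → (i , j)) (filter (λ i → inSkew? lam mu i j) (map suc (upTo (length lam)))))
            (map suc (downFrom (part lam 1)))

-- a filling of D(λ/μ) is a function on cells (only values on cells matter)
Filling : Set
Filling = ℕ → ℕ → ℕ

app : Filling → Cell → ℕ
app F c = F (proj₁ c) (proj₂ c)

word : List ℕ → List ℕ → Filling → List ℕ
word lam mu F = map (app F) (readCells lam mu)

count : ℕ → List ℕ → ℕ
count k w = length (filter (λ x → k ≟ x) w)

wt : List ℕ → List ℕ → Filling → ℕ → ℕ
wt lam mu F k = count k (word lam mu F)

wtRows : List ℕ → List ℕ → Filling → ℕ → ℕ → ℕ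
wtRows lam mu F r k = length (filter (λ c → (proj₁ c ≤? r) ×-dec (k ≟ app F c)) (readCells lam mu))

Yamanouchi : List ℕ → Set
Yamanouchi w = ∀ m k → count (suc (suc k)) (take m w) ≤ count (suc k) (take m w)

SST : ℕ → List ℕ → List ℕ → Filling → Set
SST n lam mu T =
  (∀ i j → InSkew lam mu i j → 1 ≤ T i j × T i j ≤ 2 * n)
  × (∀ i j j' → InSkew lam mu i j → InSkew lam mu i j' → j ≤ j' → T i j ≤ T i j')
  × (∀ i i' j → InSkew lam mu i j → InSkew lam mu i' j → i < i' → T i j < T i' j)

EvenPartitionWeight : List ℕ → List ℕ → Filling → Set
EvenPartitionWeight lam mu F =
  (∀ k → wt lam mu F (suc (suc k)) ≤ wt lam mu F (suc k))
  × (∀ i → wt lam mu F (suc (2 * i)) ≡ wt lam mu F (suc (suc (2 * i))))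

LRS : ℕ → List ℕ → List ℕ → Filling → Set
LRS n lam mu T =
  SST n lam mu T
  × Yamanouchi (word lam mu T)
  × EvenPartitionWeight lam mu T
  × (∀ i j k → InSkew lam mu i j → T i j ≡ suc (2 * k) → i ≤ n + k)

conjWt : ℕ → List ℕ → List ℕ → Filling → ℕ → ℕ
conjWt n lam mu T k = length (filter (λ r → k ≤? wt lam mu T r) (map suc (upTo (2 * n))))

_≟c_ : (c d : Cell) → Dec (c ≡ d)
_≟c_ = ≡-dec _≟_ _≟_

rightmost : List Cell → Maybe Cell
rightmost [] = nothing
rightmost (c ∷ cs) = pick (rightmost cs)
  where
  pick : Maybe Cell → Maybe Cell
  pick nothing  = just c
  pick (just d) = if proj₂ d ≤ᵇ proj₂ c then just c else just d

-- J_k : for i = 1..ν^t_k, the rightmost cell among the remaining cells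
-- (those of D(μ^{(k-1)}/μ)) whose entry in T is i
stripAt : ℕ → List ℕ → List ℕ → Filling → ℕ → List Cell → List Cell
stripAt n lam mu T k rem =
  catMaybes (map (λ i → rightmost (filter (λ c → app T c ≟ i) rem))
                 (map suc (upTo (conjWt n lam mu T k))))

removeCells : List Cell → List Cell → List Cell
removeCells J rem = filter (λ c → ¬? (Data.List.Relation.Unary.Any.any? (λ d → c ≟c d) J)) rem
  where import Data.List.Relation.Unary.Any

strips : ℕ → List ℕ → List ℕ → Filling → ℕ → ℕ → List Cell → List (List Cell)
strips n lam mu T zero    k rem = []
strips n lam mu T (suc m) k rem =
  stripAt n lam mu T k rem ∷ strips n lam mu T m (suc k) (removeCells (stripAt n lam mu T k rem) rem)

-- label of a cell: the k with c ∈ J_k (0 if none)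
labelOf : ℕ → List (List Cell) → Cell → ℕ
labelOf k []       c = 0
labelOf k (J ∷ Js) c = if ⌊ Data.List.Relation.Unary.Any.any? (λ d → c ≟c d) J ⌋ then k else labelOf (suc k) Js c
  where import Data.List.Relation.Unary.Any

-- the strips J_1, ..., J_{ν_1} of T, where ν_1 = T[1]
stripDecomp : ℕ → List ℕ → List ℕ → Filling → List (List Cell)
stripDecomp n lam mu T = strips n lam mu T (wt lam mu T 1) 1 (readCells lam mu)

diamond : ℕ → List ℕ → List ℕ → Filling → Filling
diamond n lam mu T i j = labelOf 1 (stripDecomp n lam mu T) (i , j)

-- ℓ(μ^{(k-1)}) where D(μ^{(k-1)}) = D(μ) ∪ {cells of D(λ/μ) with Q ≥ k}:
-- the largest index of a nonempty row
lenAbove : List ℕ → List ℕ → Filling → ℕ → ℕ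
lenAbove lam mu Q k = foldr _⊔_ (length mu) (map proj₁ (filter (λ c → k ≤? app Q c) (readCells lam mu)))

Rec : ℕ → List ℕ → List ℕ → Filling → Set
Rec n lam mu Q =
  (∀ i j → InSkew lam mu i j → 1 ≤ Q i j)
  × (∀ i j j' → InSkew lam mu i j → InSkew lam mu i j' → j < j' → Q i j' < Q i j)
  × (∀ i i' j → InSkew lam mu i j → InSkew lam mu i' j → i ≤ i' → Q i' j ≤ Q i j)
  × (∀ k → 1 ≤ k → 2 ∣ wt lam mu Q k)
  × (∀ k → 1 ≤ k → 2 * (lenAbove lam mu Q k ∸ n) ≤ wt lam mu Q k)
  × (∀ r k → 1 ≤ r → 1 ≤ k → wtRows lam mu Q r (suc k) ≤ wtRows lam mu Q r k)

_≈[_/_]_ : Filling → List ℕ → List ℕ → Filling → Set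
F ≈[ lam / mu ] G = ∀ i j → InSkew lam mu i j → F i j ≡ G i j

{-# OPTIONS --safe #-}
module Submission where

-- Cells with equal entry in T lie in distinct columns, so ◊T labels a cell by
-- its rank from the right among the cells with the same entry of T. Conversely,
-- cells with equal entry in Q lie in distinct rows, and T labels a cell by its
-- rank from the top among the cells with the same entry of Q. Both directions
-- index the cells as c_{i,k} (entry i in T, entry k in Q), where c_{i+1,k} is
-- strictly below and weakly left of c_{i,k}, and c_{i,k+1} is weakly below and
-- strictly left of c_{i,k}: the first is the Yamanouchi condition on T, the
-- second is (R5). Given this, the weights of T and Q are conjugate, and (R4)
-- corresponds to condition (iii) because both bound the entries of T below row n.

open import Defs
open import Data.Nat using (ℕ; zero; suc; _+_; _*_; _∸_; _⊔_; _≤_; _<_; z≤n; s≤s; s≤s⁻¹; _≤?_; _≟_; _≤ᵇ_)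
open import Data.Nat.Properties
open import Data.Nat.Divisibility using (_∣_; divides)
open import Data.Bool as Bool using (true; false)
open import Data.Maybe using (Maybe; just; nothing)
open import Data.List using (List; []; _∷_; _++_; length; map; filter; upTo; downFrom; take; foldr; catMaybes)
open import Data.List.Properties using (length-map; length-upTo; length-filter; length-++-sucʳ; take-map; take-all)
open import Data.List.Membership.Propositional using (_∈_; find; lose)
open import Data.List.Membership.Propositional.Properties
open import Data.List.Relation.Unary.Any as Any using (here; there)
open import Data.List.Relation.Unary.All as All using ([]; _∷_)
import Data.List.Relation.Unary.All.Properties as All
open import Data.List.Relation.Unary.Linked using (Linked; []; [-]; _∷_)
open import Data.List.Relation.Unary.AllPairs as AllPairs using (AllPairs; []; _∷_)
import Data.List.Relation.Unary.AllPairs.Properties as AllPairs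
open import Data.List.Relation.Unary.Unique.Propositional using (Unique)
import Data.List.Relation.Unary.Unique.Propositional.Properties as Unique
open import Data.Product using (Σ; ∃; _×_; _,_; proj₁; proj₂)
open import Data.Sum using (_⊎_; inj₁; inj₂)
open import Function using (_∘_)
open import Relation.Nullary using (Dec; yes; no; does; ¬_; ¬?; contradiction)
open import Relation.Nullary.Decidable using (_×-dec_)
open import Relation.Binary.Definitions using (tri<; tri≈; tri>)
open import Relation.Binary.PropositionalEquality using (_≡_; _≢_; refl; sym; trans; cong; cong₂; subst; subst₂)

-- Counting in lists

∈-++∷⁻ : ∀ {A : Set} {x y : A} as {bs} → x ∈ as ++ y ∷ bs → x ≡ y ⊎ x ∈ as ++ bs
∈-++∷⁻ []       (here eq) = inj₁ eq
∈-++∷⁻ []       (there p) = inj₂ p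
∈-++∷⁻ (_ ∷ as) (here eq) = inj₂ (here eq)
∈-++∷⁻ (_ ∷ as) (there p) with ∈-++∷⁻ as p
... | inj₁ eq = inj₁ eq
... | inj₂ q  = inj₂ (there q)

-- A relation in place of a function spares the choice of images: totality and injectivity suffice.
-- The partner of the head is cut out of `ys`; by injectivity no element of the tail is related to
-- it, so the tail stays total into the rest.
length-injection : ∀ {A B : Set} (R : A → B → Set) {xs : List A} {ys : List B} → Unique xs
  → (∀ {x} → x ∈ xs → ∃ λ y → y ∈ ys × R x y)
  → (∀ {x x′ y} → x ∈ xs → x′ ∈ xs → R x y → R x′ y → x ≡ x′)
  → length xs ≤ length ys
length-injection R []           tot inj = z≤n
length-injection R {x ∷ xs} (x∉ ∷ u) tot inj with tot (here refl)
... | y , y∈ , Rxy with ∈-∃++ y∈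
... | as , bs , refl = subst (suc (length xs) ≤_) (sym (length-++-sucʳ as y bs)) (s≤s
  (length-injection R u tot′ (λ p q → inj (there p) (there q))))
  where
  tot′ : ∀ {x′} → x′ ∈ xs → ∃ λ y′ → y′ ∈ as ++ bs × R x′ y′
  tot′ p with tot (there p)
  ... | y′ , y′∈ , r with ∈-++∷⁻ as y′∈
  ... | inj₂ q    = y′ , q , r
  ... | inj₁ refl = contradiction (inj (here refl) (there p) Rxy r) (All.lookup x∉ p)

range : ℕ → List ℕ
range N = map suc (upTo N)

length-range : ∀ N → length (range N) ≡ N
length-range N = trans (length-map suc (upTo N)) (length-upTo N)

∈-range⁺ : ∀ {N i} → 1 ≤ i → i ≤ N → i ∈ range N
∈-range⁺ {i = suc i} _ i≤N = ∈-map⁺ suc (∈-upTo⁺ i≤N)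

∈-range⁻ : ∀ {N i} → i ∈ range N → 1 ≤ i × i ≤ N
∈-range⁻ i∈ with _ , j∈ , refl ← ∈-map⁻ suc i∈ = s≤s z≤n , ∈-upTo⁻ j∈

range-unique : ∀ N → Unique (range N)
range-unique N = Unique.map⁺ suc-injective (Unique.upTo⁺ N)

length≤bound : ∀ {A : Set} (g : A → ℕ) N {xs} → Unique xs
  → (∀ {x} → x ∈ xs → 1 ≤ g x × g x ≤ N)
  → (∀ {x y} → x ∈ xs → y ∈ xs → g x ≡ g y → x ≡ y)
  → length xs ≤ N
length≤bound g N {xs} u bnd inj = subst (length xs ≤_) (length-range N)
  (length-injection (λ x y → g x ≡ y) u
    (λ {x} p → g x , ∈-range⁺ (proj₁ (bnd p)) (proj₂ (bnd p)) , refl)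
    (λ p q e e′ → inj p q (trans e (sym e′))))

bound≤length : ∀ {A : Set} (g : A → ℕ) N {xs}
  → (∀ {i} → 1 ≤ i → i ≤ N → ∃ λ x → x ∈ xs × g x ≡ i)
  → N ≤ length xs
bound≤length g N {xs} sur = subst (_≤ length xs) (length-range N)
  (length-injection (λ i x → g x ≡ i) (range-unique N)
    (λ p → sur (proj₁ (∈-range⁻ p)) (proj₂ (∈-range⁻ p)))
    (λ _ _ e e′ → trans (sym e) e′))

-- If every value were below `k`, injectivity would leave at most `k - 1` elements. Applied to
-- ranks, this turns an inequality between counts into a cell of large rank.
pigeonhole : ∀ {A : Set} (g : A → ℕ) k {xs} → Unique xs
  → (∀ {x} → x ∈ xs → 1 ≤ g x)
  → (∀ {x y} → x ∈ xs → y ∈ xs → g x ≡ g y → x ≡ y)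
  → 1 ≤ k → k ≤ length xs → ∃ λ x → x ∈ xs × k ≤ g x
pigeonhole g (suc k) {xs} u pos inj _ k<len with Any.any? (λ x → suc k ≤? g x) xs
... | yes p = find p
... | no ¬p = contradiction k<len (<⇒≱ (s≤s (length≤bound g k u
    (λ x∈ → pos x∈ , ≮⇒≥ (λ k<g → ¬p (Any.map (λ { refl → k<g }) x∈))) inj)))

-- A predicate closed under predecessors holds on `1, ..., size` and nowhere else up to `N`. With
-- `P r` saying that row `r` of a partition has at least `k` cells, `size` is the `k`-th part of the
-- conjugate.
module Initial {P : ℕ → Set} (P? : ∀ i → Dec (P i)) (pred : ∀ i → P (suc (suc i)) → P (suc i)) (N : ℕ) where

  size : ℕ
  size = length (filter P? (range N))

  P-down : ∀ {i} d → 1 ≤ i → P (d + i) → P i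
  P-down                zero    _ p = p
  P-down {i = suc i} (suc d) 1≤i p = P-down d 1≤i
    (subst P (sym (+-suc d i)) (pred (d + i) (subst (P ∘ suc) (+-suc d i) p)))

  P-≤ : ∀ {i j} → 1 ≤ i → i ≤ j → P j → P i
  P-≤ {i} {j} 1≤i i≤j p = P-down (j ∸ i) 1≤i (subst P (sym (m∸n+n≡m i≤j)) p)

  P⇒≤size : ∀ {i} → i ≤ N → P i → i ≤ size
  P⇒≤size {i} i≤N p = bound≤length (λ x → x) i
    (λ {j} 1≤j j≤i → j , ∈-filter⁺ P? (∈-range⁺ 1≤j (≤-trans j≤i i≤N)) (P-≤ 1≤j j≤i p) , refl)

  ≤size⇒P : ∀ {i} → 1 ≤ i → i ≤ size → P i
  ≤size⇒P {suc i} 1≤i i≤s with P? (suc i)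
  ... | yes p = p
  ... | no ¬p = contradiction i≤s (<⇒≱ (s≤s (length≤bound (λ x → x) i (Unique.filter⁺ P? (range-unique N))
      (λ {x} x∈ → let (x∈r , px) = ∈-filter⁻ P? {xs = range N} x∈ in
        proj₁ (∈-range⁻ x∈r) , ≮⇒≥ (λ i<x → ¬p (P-≤ 1≤i i<x px)))
      (λ _ _ e → e))))

  size≤N : size ≤ N
  size≤N = subst (size ≤_) (length-range N) (length-filter P? (range N))

count-map : ∀ {A : Set} (f : A → ℕ) k xs → count k (map f xs) ≡ length (filter (λ x → k ≟ f x) xs)
count-map f k []       = refl
count-map f k (x ∷ xs) with does (k ≟ f x)
... | true  = cong suc (count-map f k xs)
... | false = count-map f k xs

foldr-⊔-upper : ∀ b {x xs} → x ∈ xs → x ≤ foldr _⊔_ b xs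
foldr-⊔-upper b {xs = y ∷ ys} (here refl) = m≤m⊔n y _
foldr-⊔-upper b {xs = y ∷ ys} (there p)   = ≤-trans (foldr-⊔-upper b p) (m≤n⊔m y _)

foldr-⊔-sel : ∀ b xs → foldr _⊔_ b xs ≡ b ⊎ foldr _⊔_ b xs ∈ xs
foldr-⊔-sel b []       = inj₁ refl
foldr-⊔-sel b (y ∷ ys) with ⊔-sel y (foldr _⊔_ b ys)
... | inj₁ e = inj₂ (here e)
... | inj₂ e with foldr-⊔-sel b ys
...   | inj₁ e′ = inj₁ (trans e e′)
...   | inj₂ p  = inj₂ (there (subst (_∈ ys) (sym e) p))

-- Prefixes of sorted lists and parity

-- Whatever precedes an element of a prefix of a sorted list is itself in the prefix. This is how
-- prefixes of the reading word are related to positions in the diagram.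
take-closed : ∀ {A : Set} {R : A → A → Set} (asym : ∀ {x y} → R x y → ¬ R y x) m {xs d e}
  → AllPairs R xs → d ∈ take m xs → e ∈ xs → R e d → e ∈ take m xs
take-closed asym (suc m) (_ ∷ _)   _           (here refl) _ = here refl
take-closed asym (suc m) (h ∷ _)   (here refl) (there e∈)  r = contradiction (All.lookup h e∈) (asym r)
take-closed asym (suc m) (_ ∷ ap)  (there d∈)  (there e∈)  r = there (take-closed asym m ap d∈ e∈ r)

take-upto : ∀ {A : Set} {R : A → A → Set} {xs c} → AllPairs R xs → c ∈ xs
  → ∃ λ m → c ∈ take m xs × (∀ {d} → d ∈ take m xs → d ≡ c ⊎ R d c)
take-upto (_ ∷ _)  (here refl) = 1 , here refl , λ { (here e) → inj₁ e }
take-upto (h ∷ ap) (there c∈) with take-upto ap c∈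
... | m , c∈m , f = suc m , there c∈m ,
  λ { (here refl) → inj₂ (All.lookup h c∈) ; (there d∈) → f d∈ }

∈-take : ∀ {A : Set} m {xs : List A} {x} → x ∈ take m xs → x ∈ xs
∈-take (suc m) {_ ∷ _} (here e)  = here e
∈-take (suc m) {_ ∷ _} (there p) = there (∈-take m p)

even-or-odd : ∀ m → ∃ λ p → m ≡ 2 * p ⊎ m ≡ suc (2 * p)
even-or-odd zero    = 0 , inj₁ refl
even-or-odd (suc m) with even-or-odd m
... | p , inj₁ e = p , inj₂ (cong suc e)
... | p , inj₂ e = suc p , inj₁ (trans (cong suc e) (sym (*-suc 2 p)))

-- Ranks in finite forests of chains

module Rank {A : Set} (xs : List A) (unique : Unique xs)
  {_≼_ : A → A → Set} (_≼?_ : ∀ x y → Dec (x ≼ y))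
  (≼-refl : ∀ {x} → x ≼ x)
  (≼-trans : ∀ {x y z} → x ≼ y → y ≼ z → x ≼ z)
  (≼-antisym : ∀ {x y} → x ∈ xs → y ∈ xs → x ≼ y → y ≼ x → x ≡ y)
  (≼-chain : ∀ {x y z} → x ≼ z → y ≼ z → x ≼ y ⊎ y ≼ x)
  where

  below : A → List A
  below y = filter (_≼? y) xs

  rank : A → ℕ
  rank y = length (below y)

  below-unique : ∀ y → Unique (below y)
  below-unique y = Unique.filter⁺ (_≼? y) unique

  ∈-below⁺ : ∀ {x y} → x ∈ xs → x ≼ y → x ∈ below y
  ∈-below⁺ {y = y} = ∈-filter⁺ (_≼? y)

  ∈-below⁻ : ∀ {x y} → x ∈ below y → x ∈ xs × x ≼ y
  ∈-below⁻ {y = y} = ∈-filter⁻ (_≼? y)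

  rank-mono : ∀ {x y} → x ≼ y → rank x ≤ rank y
  rank-mono {x} x≼y = length-injection _≡_ (below-unique x)
    (λ {z} p → let (z∈ , z≼x) = ∈-below⁻ p in z , ∈-below⁺ z∈ (≼-trans z≼x x≼y) , refl)
    (λ _ _ e e′ → trans e (sym e′))

  rank-strict : ∀ {x y} → y ∈ xs → x ≼ y → ¬ y ≼ x → rank x < rank y
  rank-strict {x} {y} y∈ x≼y y⋠x = length-injection _≡_ {xs = y ∷ below x}
    (All.tabulate (λ z∈ → λ { refl → y⋠x (proj₂ (∈-below⁻ z∈)) }) ∷ below-unique x)
    (λ { (here refl) → y , ∈-below⁺ y∈ ≼-refl , refl
       ; {z} (there p) → let (z∈ , z≼x) = ∈-below⁻ p in z , ∈-below⁺ z∈ (≼-trans z≼x x≼y) , refl })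
    (λ _ _ e e′ → trans e (sym e′))

  rank-pos : ∀ {y} → y ∈ xs → 1 ≤ rank y
  rank-pos {y} y∈ = length-injection _≡_ {xs = y ∷ []} ([] ∷ [])
    (λ { (here refl) → y , ∈-below⁺ y∈ ≼-refl , refl })
    (λ _ _ e e′ → trans e (sym e′))

  rank-inj : ∀ {x y} → x ∈ xs → y ∈ xs → x ≼ y → rank x ≡ rank y → x ≡ y
  rank-inj {x} {y} x∈ y∈ x≼y e with y ≼? x
  ... | yes y≼x = ≼-antisym x∈ y∈ x≼y y≼x
  ... | no  y⋠x = contradiction e (<⇒≢ (rank-strict y∈ x≼y y⋠x))

  greatest : ∀ {y} zs → (∀ {z} → z ∈ zs → z ≼ y)
    → (∀ {z} → ¬ z ∈ zs) ⊎ ∃ λ m → m ∈ zs × (∀ {z} → z ∈ zs → z ≼ m)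
  greatest []       _  = inj₁ λ ()
  greatest (w ∷ zs) ub with greatest zs (ub ∘ there)
  ... | inj₁ none = inj₂ (w , here refl , λ { (here refl) → ≼-refl ; (there p) → contradiction p none })
  ... | inj₂ (m , m∈ , max) with ≼-chain (ub (here refl)) (ub (there m∈))
  ...   | inj₁ w≼m = inj₂ (m , there m∈ , λ { (here refl) → w≼m ; (there p) → max p })
  ...   | inj₂ m≼w = inj₂ (w , here refl , λ { (here refl) → ≼-refl ; (there p) → ≼-trans (max p) m≼w })

  -- The elements strictly below `y` form a chain. Its greatest element `m` satisfies `below y` =
  -- `below m` plus `y`, so its rank is one less; if the chain were empty, `y` would have rank at
  -- most one.
  rank-pred : ∀ {y k} → y ∈ xs → rank y ≡ suc (suc k) → ∃ λ x → x ∈ xs × x ≼ y × rank x ≡ suc k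
  rank-pred {y} {k} y∈ eq = result
    where
    strictly? : ∀ z → Dec (z ≼ y × ¬ y ≼ z)
    strictly? z = (z ≼? y) ×-dec ¬? (y ≼? z)

    cover : ∀ ws → (∀ {z} → z ∈ xs → z ≼ y → ¬ y ≼ z → z ∈ ws) → rank y ≤ suc (length ws)
    cover ws f = length-injection _≡_ {ys = y ∷ ws} (below-unique y) to (λ _ _ e e′ → trans e (sym e′))
      where
      to : ∀ {z} → z ∈ below y → ∃ λ w → w ∈ y ∷ ws × z ≡ w
      to {z} p with ∈-below⁻ p | y ≼? z
      ... | z∈ , z≼y | yes y≼z = z , here (≼-antisym z∈ y∈ z≼y y≼z) , refl
      ... | z∈ , z≼y | no  y⋠z = z , there (f z∈ z≼y y⋠z) , refl

    result : ∃ λ x → x ∈ xs × x ≼ y × rank x ≡ suc k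
    result with greatest (filter strictly? xs) (λ p → proj₁ (proj₂ (∈-filter⁻ strictly? {xs = xs} p)))
    ... | inj₁ none = contradiction
      (≤-trans (≤-reflexive (sym eq)) (cover [] (λ z∈ z≼y y⋠z → contradiction (∈-filter⁺ strictly? z∈ (z≼y , y⋠z)) none)))
      (λ { (s≤s ()) })
    ... | inj₂ (m , m∈ , max) = m , proj₁ m∈′ , proj₁ (proj₂ m∈′) , ≤-antisym
      (s≤s⁻¹ (subst (rank m <_) eq (rank-strict y∈ (proj₁ (proj₂ m∈′)) (proj₂ (proj₂ m∈′)))))
      (s≤s⁻¹ (subst (_≤ suc (rank m)) eq (cover (below m)
        (λ z∈ z≼y y⋠z → ∈-below⁺ z∈ (max (∈-filter⁺ strictly? z∈ (z≼y , y⋠z)))))))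
      where m∈′ = ∈-filter⁻ strictly? {xs = xs} m∈

  module _ (g : A → ℕ)
    (g-pred : ∀ {y k} → y ∈ xs → g y ≡ suc (suc k) → ∃ λ x → x ∈ xs × x ≼ y × g x ≡ suc k)
    where

    descend-by : ∀ d {y k} → y ∈ xs → g y ≡ d + suc k → ∃ λ x → x ∈ xs × x ≼ y × g x ≡ suc k
    descend-by zero    y∈ e = _ , y∈ , ≼-refl , e
    descend-by (suc d) {y} {k} y∈ e with g-pred y∈ (trans e (cong suc (+-suc d k)))
    ... | x , x∈ , x≼y , e′ with descend-by d x∈ (trans e′ (sym (+-suc d k)))
    ...   | w , w∈ , w≼x , e″ = w , w∈ , ≼-trans w≼x x≼y , e″

    descend : ∀ {y k} → y ∈ xs → 1 ≤ k → k ≤ g y → ∃ λ x → x ∈ xs × x ≼ y × g x ≡ k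
    descend {y} {suc k} y∈ _ k≤ = descend-by (g y ∸ suc k) y∈ (sym (m∸n+n≡m k≤))

    module _ (g-pos : ∀ {y} → y ∈ xs → 1 ≤ g y)
      (g-inj : ∀ {x y} → x ∈ xs → y ∈ xs → x ≼ y → g x ≡ g y → x ≡ y)
      where

      -- If `g y < g x`, descending from `x` to the value `g y` reaches some `w ≼ x ≼ y` with
      -- `g w ≡ g y`. Injectivity makes `w` equal to `y`, hence `x` equal to `y`.
      g-mono : ∀ {x y} → x ∈ xs → y ∈ xs → x ≼ y → g x ≤ g y
      g-mono {x} {y} x∈ y∈ x≼y with g x ≤? g y
      ... | yes p = p
      ... | no ¬p with descend x∈ (g-pos y∈) (<⇒≤ (≰⇒> ¬p))
      ...   | w , w∈ , w≼x , e with g-inj w∈ y∈ (≼-trans w≼x x≼y) e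
      ...     | refl with ≼-antisym x∈ y∈ x≼y w≼x
      ...       | refl = ≤-refl

      -- On the chain below `y` the function `g` takes each of the values `1, ..., g y` exactly
      -- once. It serves to recover each of `T` and `Q` from the other.
      rank-characterised : ∀ {y} → y ∈ xs → rank y ≡ g y
      rank-characterised {y} y∈ = ≤-antisym
        (length≤bound g (g y) (below-unique y)
          (λ p → let (x∈ , x≼y) = ∈-below⁻ p in g-pos x∈ , g-mono x∈ y∈ x≼y) inj)
        (bound≤length g (g y) (λ 1≤i i≤g → let (x , x∈ , x≼y , e) = descend y∈ 1≤i i≤g in x , ∈-below⁺ x∈ x≼y , e))
        where
        inj : ∀ {x x′} → x ∈ below y → x′ ∈ below y → g x ≡ g x′ → x ≡ x′
        inj p q e with ∈-below⁻ p | ∈-below⁻ q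
        ... | x∈ , x≼y | x′∈ , x′≼y with ≼-chain x≼y x′≼y
        ...   | inj₁ r = g-inj x∈ x′∈ r e
        ...   | inj₂ r = sym (g-inj x′∈ x∈ r (sym e))

  rank-descend : ∀ {y k} → y ∈ xs → 1 ≤ k → k ≤ rank y → ∃ λ x → x ∈ xs × x ≼ y × rank x ≡ k
  rank-descend = descend rank rank-pred

-- Skew diagrams

row col : Cell → ℕ
row = proj₁
col = proj₂

at-antitone : ∀ {γ} → Linked (λ a b → b ≤ a) γ → ∀ {i j} → i ≤ j → at γ j ≤ at γ i
at-antitone []                            _   = z≤n
at-antitone [-]       {j = zero}  z≤n         = ≤-refl
at-antitone [-]       {j = suc j} _           = z≤n
at-antitone (_ ∷ _)   {j = zero}  z≤n         = ≤-refl
at-antitone (le ∷ ls) {zero} {suc j} z≤n      = ≤-trans (at-antitone ls {0} {j} z≤n) le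
at-antitone (_ ∷ ls)              (s≤s i≤j)   = at-antitone ls i≤j

at-beyond : ∀ γ {i} → length γ ≤ i → at γ i ≡ 0
at-beyond []      _                     = refl
at-beyond (_ ∷ γ) {suc i} (s≤s len≤i)   = at-beyond γ len≤i

part-beyond : ∀ γ {i} → length γ < i → part γ i ≡ 0
part-beyond γ {suc i} (s≤s len≤i) = at-beyond γ len≤i

-- The reading order of the Yamanouchi condition: columns from right to left, each from top to
-- bottom.
_≺ᴿ_ : Cell → Cell → Set
c ≺ᴿ d = col d < col c ⊎ (col c ≡ col d × row c < row d)

≺ᴿ-asym : ∀ {c d} → c ≺ᴿ d → ¬ d ≺ᴿ c
≺ᴿ-asym (inj₁ p)       (inj₁ q)       = <-asym p q
≺ᴿ-asym (inj₁ p)       (inj₂ (e , _)) = <-irrefl e p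
≺ᴿ-asym (inj₂ (e , _)) (inj₁ q)       = <-irrefl e q
≺ᴿ-asym (inj₂ (_ , p)) (inj₂ (_ , q)) = <-asym p q

≺ᴿ-irrefl : ∀ {c d} → c ≺ᴿ d → c ≢ d
≺ᴿ-irrefl r refl = ≺ᴿ-asym r r

module Shape (lam mu : List ℕ) (lam-desc : Linked (λ a b → b ≤ a) lam) where

  cells : List Cell
  cells = readCells lam mu

  column : ℕ → List Cell
  column j = map (λ i → (i , j)) (filter (λ i → inSkew? lam mu i j) (range (length lam)))

  part-antitone : ∀ {i i′} → 1 ≤ i → i ≤ i′ → part lam i′ ≤ part lam i
  part-antitone {suc i} {suc i′} _ (s≤s i≤i′) = at-antitone lam-desc i≤i′

  1≤row : ∀ {i j} → InSkew lam mu i j → 1 ≤ i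
  1≤row {zero}  (lo , hi) = contradiction (<-≤-trans lo hi) (<-irrefl refl)
  1≤row {suc i} _         = s≤s z≤n

  row≤length : ∀ {i j} → InSkew lam mu i j → i ≤ length lam
  row≤length {i} {j} (lo , hi) = ≮⇒≥ λ len<i →
    n≮0 (<-≤-trans lo (subst (j ≤_) (part-beyond lam len<i) hi))

  ∈-cells⁺ : ∀ {i j} → InSkew lam mu i j → (i , j) ∈ cells
  ∈-cells⁺ {i} {zero}  (() , _)
  ∈-cells⁺ {i} {suc j} s@(_ , hi) = ∈-concatMap⁺ column
    (lose (∈-map⁺ suc (∈-downFrom⁺ (≤-trans hi (part-antitone (s≤s z≤n) (1≤row {i} s)))))
      (∈-map⁺ (λ i → (i , suc j)) (∈-filter⁺ (λ i → inSkew? lam mu i (suc j)) (∈-range⁺ (1≤row s) (row≤length s)) s)))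

  ∈-column⁻ : ∀ {j c} → c ∈ column j → InSkew lam mu (row c) (col c) × col c ≡ j
  ∈-column⁻ {j} c∈ with ∈-map⁻ (λ i → (i , j)) c∈
  ... | i , i∈ , refl = proj₂ (∈-filter⁻ (λ i → inSkew? lam mu i j) {xs = range (length lam)} i∈) , refl

  ∈-cells⁻ : ∀ {c} → c ∈ cells → InSkew lam mu (row c) (col c)
  ∈-cells⁻ c∈ with find (∈-concatMap⁻ column {xs = map suc (downFrom (part lam 1))} c∈)
  ... | j , _ , c∈col = proj₁ (∈-column⁻ {j} c∈col)

  cells-sorted : AllPairs _≺ᴿ_ cells
  cells-sorted = AllPairs.concat⁺
    (All.map⁺ (All.tabulate (λ {j} _ → AllPairs.map⁺ (AllPairs.filter⁺ (λ i → inSkew? lam mu i j)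
      (AllPairs.map⁺ (AllPairs.applyUpTo⁺₁ (λ i → i) (length lam) (λ i<i′ _ → inj₂ (refl , s≤s i<i′))))))))
    (AllPairs.map⁺ (AllPairs.map⁺ (AllPairs.applyDownFrom⁺₁ (λ j → j) (part lam 1)
      (λ {j} {j′} j′<j _ → All.tabulate (λ {c} c∈ → All.tabulate (λ {d} d∈ →
        inj₁ (subst (_< col c) (sym (proj₂ (∈-column⁻ {suc j′} d∈)))
               (subst (suc j′ <_) (sym (proj₂ (∈-column⁻ {suc j} c∈))) (s≤s j′<j)))))))))

  cells-unique : Unique cells
  cells-unique = AllPairs.map ≺ᴿ-irrefl cells-sorted

  -- This cell is weakly right of `x` in its row, hence outside `mu`, and weakly above `y` in its
  -- column, hence inside `lam`. Going through it combines a row condition and a column condition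
  -- into one comparison of `x` and `y`.
  corner : ∀ {x y} → x ∈ cells → y ∈ cells → row x ≤ row y → col x ≤ col y → InSkew lam mu (row x) (col y)
  corner x∈ y∈ r c = <-≤-trans (proj₁ (∈-cells⁻ x∈)) c ,
    ≤-trans (proj₂ (∈-cells⁻ y∈)) (part-antitone (1≤row (∈-cells⁻ x∈)) r)

  class : Filling → ℕ → List Cell
  class F k = filter (λ c → k ≟ app F c) cells

  class-unique : ∀ F k → Unique (class F k)
  class-unique F k = Unique.filter⁺ (λ c → k ≟ app F c) cells-unique

  ∈-class⁺ : ∀ F {k c} → c ∈ cells → app F c ≡ k → c ∈ class F k
  ∈-class⁺ F {k} c∈ e = ∈-filter⁺ (λ c → k ≟ app F c) c∈ (sym e)

  ∈-class⁻ : ∀ F {k c} → c ∈ class F k → c ∈ cells × app F c ≡ k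
  ∈-class⁻ F {k} p with ∈-filter⁻ (λ c → k ≟ app F c) {xs = cells} p
  ... | c∈ , e = c∈ , sym e

  wt-class : ∀ F k → wt lam mu F k ≡ length (class F k)
  wt-class F k = count-map (app F) k cells

  count-prefix : ∀ F k m
    → count k (take m (word lam mu F)) ≡ length (filter (λ c → k ≟ app F c) (take m cells))
  count-prefix F k m = trans (cong (count k) (take-map m cells)) (count-map (app F) k (take m cells))

  -- Ranks along columns and rows, and doubly indexed cells

  module ByColumn (T : Filling)
    (distinct : ∀ {x y} → x ∈ cells → y ∈ cells → app T x ≡ app T y → col x ≡ col y → x ≡ y) where

    _≼_ : Cell → Cell → Set
    x ≼ y = app T x ≡ app T y × col y ≤ col x

    _≼?_ : ∀ x y → Dec (x ≼ y)
    x ≼? y = (app T x ≟ app T y) ×-dec (col y ≤? col x)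

    ≼-trans : ∀ {x y z} → x ≼ y → y ≼ z → x ≼ z
    ≼-trans (e , p) (e′ , p′) = trans e e′ , ≤-trans p′ p

    ≼-antisym : ∀ {x y} → x ∈ cells → y ∈ cells → x ≼ y → y ≼ x → x ≡ y
    ≼-antisym x∈ y∈ (e , p) (_ , p′) = distinct x∈ y∈ e (≤-antisym p′ p)

    ≼-chain : ∀ {x y z} → x ≼ z → y ≼ z → x ≼ y ⊎ y ≼ x
    ≼-chain {x} {y} (e , _) (e′ , _) with ≤-total (col x) (col y)
    ... | inj₁ p = inj₂ (trans e′ (sym e) , p)
    ... | inj₂ p = inj₁ (trans e (sym e′) , p)

    open Rank cells cells-unique {_≼_} _≼?_ (refl , ≤-refl)
      (λ {x} {y} {z} → ≼-trans {x} {y} {z}) ≼-antisym (λ {x} {y} {z} → ≼-chain {x} {y} {z}) public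

    class-inj : ∀ {x y} → x ∈ cells → y ∈ cells → app T x ≡ app T y → rank x ≡ rank y → x ≡ y
    class-inj {x} {y} x∈ y∈ e r with ≤-total (col x) (col y)
    ... | inj₁ p = sym (rank-inj y∈ x∈ (sym e , p) (sym r))
    ... | inj₂ p = rank-inj x∈ y∈ (e , p) r

  module ByRow (Q : Filling)
    (distinct : ∀ {x y} → x ∈ cells → y ∈ cells → app Q x ≡ app Q y → row x ≡ row y → x ≡ y) where

    -- The order of the conjuncts and the direction of the equation follow `wtRows`, so that
    -- `rank y` is definitionally `wtRows lam mu Q (row y) (app Q y)`.
    _≼_ : Cell → Cell → Set
    x ≼ y = row x ≤ row y × app Q y ≡ app Q x

    _≼?_ : ∀ x y → Dec (x ≼ y)
    x ≼? y = (row x ≤? row y) ×-dec (app Q y ≟ app Q x)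

    ≼-trans : ∀ {x y z} → x ≼ y → y ≼ z → x ≼ z
    ≼-trans (p , e) (p′ , e′) = ≤-trans p p′ , trans e′ e

    ≼-antisym : ∀ {x y} → x ∈ cells → y ∈ cells → x ≼ y → y ≼ x → x ≡ y
    ≼-antisym x∈ y∈ (p , e) (p′ , _) = distinct x∈ y∈ (sym e) (≤-antisym p p′)

    ≼-chain : ∀ {x y z} → x ≼ z → y ≼ z → x ≼ y ⊎ y ≼ x
    ≼-chain {x} {y} (_ , e) (_ , e′) with ≤-total (row x) (row y)
    ... | inj₁ p = inj₁ (p , trans (sym e′) e)
    ... | inj₂ p = inj₂ (p , trans (sym e) e′)

    open Rank cells cells-unique {_≼_} _≼?_ (≤-refl , refl)
      (λ {x} {y} {z} → ≼-trans {x} {y} {z}) ≼-antisym (λ {x} {y} {z} → ≼-chain {x} {y} {z}) public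

    class-inj : ∀ {x y} → x ∈ cells → y ∈ cells → app Q x ≡ app Q y → rank x ≡ rank y → x ≡ y
    class-inj {x} {y} x∈ y∈ e r with ≤-total (row x) (row y)
    ... | inj₁ p = rank-inj x∈ y∈ (p , sym e) r
    ... | inj₂ p = sym (rank-inj y∈ x∈ (p , e) (sym r))

  -- The pair (T , Q) indexes the cells as c_{i,k}, with i = T and k = Q, over
  -- a diagram of indices closed under decreasing i and decreasing k.
  record Biranked (T Q : Filling) : Set where
    field
      T-pos : ∀ {x} → x ∈ cells → 1 ≤ app T x
      Q-pos : ∀ {x} → x ∈ cells → 1 ≤ app Q x
      index-inj : ∀ {x y} → x ∈ cells → y ∈ cells → app T x ≡ app T y → app Q x ≡ app Q y → x ≡ y
      T-pred : ∀ {x t} → x ∈ cells → app T x ≡ suc (suc t) → ∃ λ e → e ∈ cells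
        × app T e ≡ suc t × app Q e ≡ app Q x × row e < row x × col x ≤ col e
      Q-pred : ∀ {x k} → x ∈ cells → app Q x ≡ suc (suc k) → ∃ λ e → e ∈ cells
        × app Q e ≡ suc k × app T e ≡ app T x × row e ≤ row x × col x < col e

    -- Each use of `T-pred` climbs at least one row, so the rows climbed are at least the drop in
    -- the entry. Condition (iii) for a reconstructed tableau rests on this count.
    T-descend-by : ∀ d {x t} → x ∈ cells → app T x ≡ d + suc t → ∃ λ e → e ∈ cells
      × app T e ≡ suc t × app Q e ≡ app Q x × row e + d ≤ row x × col x ≤ col e
    T-descend-by zero {x} x∈ eq = x , x∈ , eq , refl , ≤-reflexive (+-identityʳ (row x)) , ≤-refl
    T-descend-by (suc d) {x} {t} x∈ eq with T-pred x∈ (trans eq (cong suc (+-suc d t)))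
    ... | y , y∈ , Ty , Qy , ry , cy with T-descend-by d y∈ (trans Ty (sym (+-suc d t)))
    ...   | e , e∈ , Te , Qe , re , ce = e , e∈ , Te , trans Qe Qy ,
      ≤-trans (≤-reflexive (+-suc (row e) d)) (≤-trans (s≤s re) ry) , ≤-trans cy ce

    T-descend : ∀ {x t} → x ∈ cells → 1 ≤ t → t ≤ app T x → ∃ λ e → e ∈ cells
      × app T e ≡ t × app Q e ≡ app Q x × row e + (app T x ∸ t) ≤ row x × col x ≤ col e
    T-descend {x} {suc t} x∈ _ t≤ = T-descend-by (app T x ∸ suc t) x∈ (sym (m∸n+n≡m t≤))

  open Biranked

  biranked-resp : ∀ {T Q Q′} → Q ≈[ lam / mu ] Q′ → Biranked T Q → Biranked T Q′
  biranked-resp {T} {Q} {Q′} eq b = record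
    { T-pos = T-pos b
    ; Q-pos = λ x∈ → subst (1 ≤_) (on x∈) (Q-pos b x∈)
    ; index-inj = λ x∈ y∈ e e′ → index-inj b x∈ y∈ e (trans (on x∈) (trans e′ (sym (on y∈))))
    ; T-pred = λ x∈ e → let (y , y∈ , Ty , Qy , rest) = T-pred b x∈ e in
        y , y∈ , Ty , trans (sym (on y∈)) (trans Qy (on x∈)) , rest
    ; Q-pred = λ x∈ e → let (y , y∈ , Qy , rest) = Q-pred b x∈ (trans (on x∈) e) in
        y , y∈ , trans (sym (on y∈)) Qy , rest
    }
    where
    on : ∀ {x} → x ∈ cells → app Q x ≡ app Q′ x
    on {i , j} x∈ = eq i j (∈-cells⁻ x∈)

  -- The left side depends on `Q` alone, which makes the relabelling injective.
  biranked⇒T : ∀ {T Q} → Biranked T Q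
    → (∀ {x y} → x ∈ cells → y ∈ cells → app Q x ≡ app Q y → row x ≡ row y → x ≡ y)
    → ∀ {x} → x ∈ cells → wtRows lam mu Q (row x) (app Q x) ≡ app T x
  biranked⇒T {T} {Q} b distinct x∈ = ByRow.rank-characterised Q distinct (app T)
    (λ y∈ e → let (z , z∈ , Tz , Qz , r , _) = T-pred b y∈ e in z , z∈ , (<⇒≤ r , sym Qz) , Tz)
    (T-pos b) (λ { y∈ z∈ (_ , e) e′ → index-inj b y∈ z∈ e′ (sym e) }) x∈

  biranked⇒Q : ∀ {T Q} → Biranked T Q
    → (distinct : ∀ {x y} → x ∈ cells → y ∈ cells → app T x ≡ app T y → col x ≡ col y → x ≡ y)
    → ∀ {x} → x ∈ cells → ByColumn.rank T distinct x ≡ app Q x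
  biranked⇒Q {T} {Q} b distinct x∈ = ByColumn.rank-characterised T distinct (app Q)
    (λ y∈ e → let (z , z∈ , Qz , Tz , _ , c) = Q-pred b y∈ e in z , z∈ , (Tz , <⇒≤ c) , Qz)
    (Q-pos b) (λ { y∈ z∈ (e , _) e′ → index-inj b y∈ z∈ e e′ }) x∈

-- The strip decomposition

data Rightmost (cs : List Cell) : Maybe Cell → Set where
  none : (∀ {c} → ¬ c ∈ cs) → Rightmost cs nothing
  some : ∀ {d} → d ∈ cs → (∀ {c} → c ∈ cs → col c ≤ col d) → Rightmost cs (just d)

rightmost-spec : ∀ cs → Rightmost cs (rightmost cs)
rightmost-spec []       = none λ ()
rightmost-spec (c ∷ cs) with rightmost cs | rightmost-spec cs
... | nothing | none empty = some (here refl) λ { (here refl) → ≤-refl ; (there p) → contradiction p empty }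
... | just d  | some d∈ max with col d ≤ᵇ col c in eq
...   | true  = some (here refl) λ
  { (here refl) → ≤-refl
  ; (there p) → ≤-trans (max p) (≤ᵇ⇒≤ (col d) (col c) (subst Bool.T (sym eq) _)) }
...   | false = some (there d∈) λ
  { (here refl) → <⇒≤ (≰⇒> (λ d≤c → subst Bool.T eq (≤⇒≤ᵇ d≤c))) ; (there p) → max p }

∈-catMaybes⁺ : ∀ {A : Set} {x : A} {ms} → just x ∈ ms → x ∈ catMaybes ms
∈-catMaybes⁺ {ms = _ ∷ _}       (here refl) = here refl
∈-catMaybes⁺ {ms = just _ ∷ _}  (there p)   = there (∈-catMaybes⁺ p)
∈-catMaybes⁺ {ms = nothing ∷ _} (there p)   = ∈-catMaybes⁺ p

∈-catMaybes⁻ : ∀ {A : Set} {x : A} {ms} → x ∈ catMaybes ms → just x ∈ ms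
∈-catMaybes⁻ {ms = just _ ∷ _}  (here refl) = here refl
∈-catMaybes⁻ {ms = just _ ∷ _}  (there p)   = there (∈-catMaybes⁻ p)
∈-catMaybes⁻ {ms = nothing ∷ _} p           = there (∈-catMaybes⁻ p)

labelOf-here : ∀ k {J} Js {c} → c ∈ J → labelOf k (J ∷ Js) c ≡ k
labelOf-here k {J} Js {c} c∈ with Any.any? (λ d → c ≟c d) J
... | yes _ = refl
... | no ¬p = contradiction c∈ ¬p

labelOf-there : ∀ k {J} Js {c} → ¬ c ∈ J → labelOf k (J ∷ Js) c ≡ labelOf (suc k) Js c
labelOf-there k {J} Js {c} c∉ with Any.any? (λ d → c ≟c d) J
... | yes p = contradiction p c∉
... | no _  = refl

∈-removeCells⁺ : ∀ J {rem c} → c ∈ rem → ¬ c ∈ J → c ∈ removeCells J rem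
∈-removeCells⁺ J = ∈-filter⁺ (λ c → ¬? (Any.any? (λ d → c ≟c d) J))

∈-removeCells⁻ : ∀ J {rem c} → c ∈ removeCells J rem → c ∈ rem × ¬ c ∈ J
∈-removeCells⁻ J = ∈-filter⁻ (λ c → ¬? (Any.any? (λ d → c ≟c d) J))

-- From Littlewood-Richardson-Sundaram tableaux to recording tableaux

module Tableau (n : ℕ) (lam mu : List ℕ) (lam-desc : Linked (λ a b → b ≤ a) lam)
  (T : Filling) (T∈LRS : LRS n lam mu T) where

  open Shape lam mu lam-desc

  T-range : ∀ {x} → x ∈ cells → 1 ≤ app T x × app T x ≤ 2 * n
  T-range x∈ = proj₁ (proj₁ T∈LRS) _ _ (∈-cells⁻ x∈)

  T-strict : ∀ {x y} → x ∈ cells → y ∈ cells → row x < row y → col x ≤ col y → app T x < app T y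
  T-strict x∈ y∈ r c = ≤-<-trans
    (proj₁ (proj₂ (proj₁ T∈LRS)) _ _ _ (∈-cells⁻ x∈) (corner x∈ y∈ (<⇒≤ r) c) c)
    (proj₂ (proj₂ (proj₁ T∈LRS)) _ _ _ (corner x∈ y∈ (<⇒≤ r) c) (∈-cells⁻ y∈) r)

  T-mono : ∀ {x y} → x ∈ cells → y ∈ cells → row x ≤ row y → col x ≤ col y → app T x ≤ app T y
  T-mono x∈ y∈ r c with m≤n⇒m<n∨m≡n r
  ... | inj₁ r<   = <⇒≤ (T-strict x∈ y∈ r< c)
  ... | inj₂ refl = proj₁ (proj₂ (proj₁ T∈LRS)) _ _ _ (∈-cells⁻ x∈) (∈-cells⁻ y∈) c

  distinct-columns : ∀ {x y} → x ∈ cells → y ∈ cells → app T x ≡ app T y → col x ≡ col y → x ≡ y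
  distinct-columns {x} {y} x∈ y∈ e c with <-cmp (row x) (row y)
  ... | tri≈ _ r _ = cong₂ _,_ r c
  ... | tri< r _ _ = contradiction e (<⇒≢ (T-strict x∈ y∈ r (≤-reflexive c)))
  ... | tri> _ _ r = contradiction (sym e) (<⇒≢ (T-strict y∈ x∈ r (≤-reflexive (sym c))))

  open ByColumn T distinct-columns

  wt-pred : ∀ k → wt lam mu T (suc (suc k)) ≤ wt lam mu T (suc k)
  wt-pred = proj₁ (proj₁ (proj₂ (proj₂ T∈LRS)))

  module Conjugate (k : ℕ) = Initial (λ r → k ≤? wt lam mu T r) (λ r p → ≤-trans p (wt-pred r)) (2 * n)

  rank≤wt : ∀ {x} → rank x ≤ wt lam mu T (app T x)
  rank≤wt {x} = subst (rank x ≤_) (sym (wt-class T (app T x))) (length-injection _≡_ (below-unique x)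
    (λ {z} p → let (z∈ , e , _) = ∈-below⁻ p in z , ∈-class⁺ T z∈ e , refl)
    (λ _ _ e e′ → trans e (sym e′)))

  wt≤wt₁ : ∀ {i} → 1 ≤ i → wt lam mu T i ≤ wt lam mu T 1
  wt≤wt₁ {suc zero}    _ = ≤-refl
  wt≤wt₁ {suc (suc i)} _ = ≤-trans (wt-pred i) (wt≤wt₁ (s≤s z≤n))

  entry≤conjWt : ∀ {x k} → x ∈ cells → k ≤ rank x → app T x ≤ conjWt n lam mu T k
  entry≤conjWt {x} {k} x∈ k≤ = Conjugate.P⇒≤size k (proj₂ (T-range x∈)) (≤-trans k≤ (rank≤wt {x}))

  strip-cell : List Cell → ℕ → Maybe Cell
  strip-cell rem i = rightmost (filter (λ c → app T c ≟ i) rem)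

  module Strip (k : ℕ) (1≤k : 1 ≤ k) (rem : List Cell)
    (rem⁻ : ∀ {c} → c ∈ rem → c ∈ cells × k ≤ rank c)
    (rem⁺ : ∀ {c} → c ∈ cells → k ≤ rank c → c ∈ rem) where

    ∈-strip⁺ : ∀ {c} → c ∈ cells → rank c ≡ k → c ∈ stripAt n lam mu T k rem
    ∈-strip⁺ {c} c∈ e = ∈-catMaybes⁺ (subst (_∈ _) found (∈-map⁺ (strip-cell rem)
      (∈-range⁺ (proj₁ (T-range c∈)) (entry≤conjWt c∈ (≤-reflexive (sym e))))))
      where
      c∈′ : c ∈ filter (λ d → app T d ≟ app T c) rem
      c∈′ = ∈-filter⁺ (λ d → app T d ≟ app T c) (rem⁺ c∈ (≤-reflexive (sym e))) refl

      found : strip-cell rem (app T c) ≡ just c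
      found with strip-cell rem (app T c) | rightmost-spec (filter (λ d → app T d ≟ app T c) rem)
      ... | nothing | none empty = contradiction c∈′ empty
      ... | just d  | some d∈ max with ∈-filter⁻ (λ d → app T d ≟ app T c) {xs = rem} d∈
      -- The rightmost cell `d` is weakly right of `c`, so its rank is at most `k`; being still in
      -- `rem`, it has rank at least `k`.
      ...   | d∈rem , Td = cong just (rank-inj (proj₁ (rem⁻ d∈rem)) c∈ (Td , max c∈′)
        (≤-antisym (rank-mono {d} {c} (Td , max c∈′)) (≤-trans (≤-reflexive e) (proj₂ (rem⁻ d∈rem)))))

    -- A selected `d` has rank at least `k`, so a cell of rank exactly `k` with the same entry lies
    -- weakly to its right. That cell is also in `rem`, and `d` is rightmost there, so the two
    -- coincide.
    ∈-strip⁻ : ∀ {d} → d ∈ stripAt n lam mu T k rem → rank d ≡ k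
    ∈-strip⁻ {d} d∈ with ∈-map⁻ (strip-cell rem) {xs = range (conjWt n lam mu T k)} (∈-catMaybes⁻ d∈)
    ... | i , _ , eq with strip-cell rem i | rightmost-spec (filter (λ c → app T c ≟ i) rem)
    ... | just d′ | some d∈f max with eq
    ... | refl with ∈-filter⁻ (λ c → app T c ≟ i) {xs = rem} d∈f
    ... | d∈rem , Td with rank-descend (proj₁ (rem⁻ d∈rem)) 1≤k (proj₂ (rem⁻ d∈rem))
    ... | c , c∈ , (Tc , cd) , rc = subst (λ x → rank x ≡ k)
      (distinct-columns c∈ (proj₁ (rem⁻ d∈rem)) Tc
        (≤-antisym (max (∈-filter⁺ (λ c → app T c ≟ i) (rem⁺ c∈ (≤-reflexive (sym rc))) (trans Tc Td))) cd))
      rc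

  -- The invariant is that `rem` consists of the cells of rank at least `k`; round `k` then removes
  -- precisely those of rank `k`. The bound `rank c < k + m` ensures that the `m` rounds left reach
  -- `c`.
  labelOf-strips : ∀ m k rem → 1 ≤ k
    → (∀ {c} → c ∈ rem → c ∈ cells × k ≤ rank c)
    → (∀ {c} → c ∈ cells → k ≤ rank c → c ∈ rem)
    → ∀ {c} → c ∈ cells → k ≤ rank c → rank c < k + m
    → labelOf k (strips n lam mu T m k rem) c ≡ rank c
  labelOf-strips zero k rem _ _ _ {c} _ k≤ <k =
    contradiction (<-≤-trans <k (≤-trans (≤-reflexive (+-identityʳ k)) k≤)) (<-irrefl refl)
  labelOf-strips (suc m) k rem 1≤k rem⁻ rem⁺ {c} c∈ k≤ <k+m with rank c ≟ k
  ... | yes e = trans (labelOf-here k Js (∈-strip⁺ c∈ e)) (sym e)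
    where
    open Strip k 1≤k rem rem⁻ rem⁺
    Js = strips n lam mu T m (suc k) (removeCells (stripAt n lam mu T k rem) rem)
  ... | no ¬e = trans (labelOf-there k Js (¬e ∘ ∈-strip⁻))
    (labelOf-strips m (suc k) _ (s≤s z≤n)
      (λ d∈ → let (d∈rem , d∉) = ∈-removeCells⁻ J d∈ ; (d∈c , k≤d) = rem⁻ d∈rem in
        d∈c , ≤∧≢⇒< k≤d (λ e → d∉ (∈-strip⁺ d∈c (sym e))))
      (λ d∈ k<d → ∈-removeCells⁺ J (rem⁺ d∈ (<⇒≤ k<d)) (λ p → <⇒≢ k<d (sym (∈-strip⁻ p))))
      c∈ (≤∧≢⇒< k≤ (¬e ∘ sym)) (subst (rank c <_) (+-suc k m) <k+m))
    where
    open Strip k 1≤k rem rem⁻ rem⁺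
    J = stripAt n lam mu T k rem
    Js = strips n lam mu T m (suc k) (removeCells J rem)

  diamond-rank : ∀ {c} → c ∈ cells → app (diamond n lam mu T) c ≡ rank c
  diamond-rank {c} c∈ = labelOf-strips (wt lam mu T 1) 1 cells ≤-refl
    (λ d∈ → d∈ , rank-pos d∈) (λ d∈ _ → d∈) c∈ (rank-pos c∈)
    -- The number of rounds is `T[1]`, the largest part of the weight, which bounds every rank.
    (s≤s (≤-trans (rank≤wt {c}) (wt≤wt₁ (proj₁ (T-range c∈)))))

  -- Consider the prefix of the reading word ending at `x`. It contains at least `rank x` entries
  -- `t + 2`, hence by the Yamanouchi condition at least `rank x` entries `t + 1`. One of these has
  -- rank at least `rank x`, and descending from it gives `e`.
  rank-T-pred : ∀ {x t} → x ∈ cells → app T x ≡ suc (suc t) → ∃ λ e → e ∈ cells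
    × app T e ≡ suc t × rank e ≡ rank x × row e < row x × col x ≤ col e
  rank-T-pred {x} {t} x∈ Tx with take-upto cells-sorted x∈
  ... | m , x∈m , upto = result
    where
    prefix : ℕ → List Cell
    prefix k = filter (λ c → k ≟ app T c) (take m cells)

    ∈-prefix⁻ : ∀ {k z} → z ∈ prefix k → z ∈ cells × z ∈ take m cells × app T z ≡ k
    ∈-prefix⁻ {k} p with ∈-filter⁻ (λ c → k ≟ app T c) {xs = take m cells} p
    ... | z∈ , e = ∈-take m z∈ , z∈ , sym e

    below⊆prefix : ∀ {z} → z ∈ cells → app T z ≡ app T x → col x ≤ col z → z ∈ prefix (suc (suc t))
    below⊆prefix {z} z∈ e c = ∈-filter⁺ (λ c → suc (suc t) ≟ app T c) z∈m (trans (sym Tx) (sym e))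
      where
      z∈m : z ∈ take m cells
      z∈m with m≤n⇒m<n∨m≡n c
      ... | inj₁ c< = take-closed ≺ᴿ-asym m cells-sorted x∈m z∈ (inj₁ c<)
      ... | inj₂ c≡ = subst (_∈ take m cells) (sym (distinct-columns z∈ x∈ e (sym c≡))) x∈m

    rank≤ : rank x ≤ length (prefix (suc t))
    rank≤ = ≤-trans
      (length-injection _≡_ (below-unique x)
        (λ {z} p → let (z∈ , e , c) = ∈-below⁻ p in z , below⊆prefix z∈ e c , refl)
        (λ _ _ e e′ → trans e (sym e′)))
      (≤-trans (≤-reflexive (sym (count-prefix T (suc (suc t)) m)))
        (≤-trans (proj₁ (proj₂ T∈LRS) m t) (≤-reflexive (count-prefix T (suc t) m))))

    result : ∃ λ e → e ∈ cells × app T e ≡ suc t × rank e ≡ rank x × row e < row x × col x ≤ col e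
    result with pigeonhole rank (rank x)
      (Unique.filter⁺ (λ c → suc t ≟ app T c) (Unique.take⁺ m cells-unique))
      (λ p → rank-pos (proj₁ (∈-prefix⁻ p)))
      (λ p q → let (y∈ , _ , Ty) = ∈-prefix⁻ p ; (z∈ , _ , Tz) = ∈-prefix⁻ q in
        class-inj y∈ z∈ (trans Ty (sym Tz)))
      (rank-pos x∈) rank≤
    ... | z , z∈p , rz with ∈-prefix⁻ z∈p
    ... | z∈ , z∈m , Tz with rank-descend z∈ (rank-pos x∈) rz
    ... | e , e∈ , (Te , ce) , re = e , e∈ , trans Te Tz , re , below-x , ≤-trans (right (upto z∈m)) ce
      where
      right : z ≡ x ⊎ z ≺ᴿ x → col x ≤ col z
      right (inj₁ refl)           = ≤-refl
      right (inj₂ (inj₁ c))       = <⇒≤ c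
      right (inj₂ (inj₂ (c , _))) = ≤-reflexive (sym c)

      -- If `e` were weakly below `x`, being weakly right of it too, its entry would be at least
      -- that of `x`.
      below-x : row e < row x
      below-x = ≰⇒> λ r → <⇒≱ (≤-reflexive (cong suc (trans Te Tz)))
        (≤-trans (≤-reflexive (sym Tx)) (T-mono x∈ e∈ r (≤-trans (right (upto z∈m)) ce)))

  biranked : Biranked T (diamond n lam mu T)
  biranked = biranked-resp {Q = λ i j → rank (i , j)} (λ i j s → sym (diamond-rank (∈-cells⁺ s))) (record
    { T-pos = λ x∈ → proj₁ (T-range x∈)
    ; Q-pos = rank-pos
    ; index-inj = class-inj
    ; T-pred = rank-T-pred
    ; Q-pred = λ {x} {k} x∈ rx → let (e , e∈ , (Te , c) , re) = rank-pred x∈ rx in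
        e , e∈ , re , Te ,
        -- A cell strictly below and weakly right of `x` would carry a larger entry; one in the same
        -- column would be `x` itself, against the ranks.
        ≮⇒≥ (λ r → <⇒≢ (T-strict x∈ e∈ r c) (sym Te)) ,
        ≤∧≢⇒< c (λ c≡ → 1+n≢n (trans (sym rx) (trans (cong rank (sym (distinct-columns e∈ x∈ Te (sym c≡)))) re)))
    })

  -- Weight and conditions (R1)-(R5) of the relabelled tableau

  module Relabelled (Q : Filling) (Q-rank : ∀ {x} → x ∈ cells → app Q x ≡ rank x) (b : Biranked T Q) where

    open Biranked b

    Q≡rank : ∀ {x k} → x ∈ class Q k → rank x ≡ k
    Q≡rank p = let (x∈ , e) = ∈-class⁻ Q p in trans (sym (Q-rank x∈)) e

    -- `T` maps the cells labelled `k` bijectively onto `1, ..., conjWt n lam mu T k`: an entry `i`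
    -- in this interval occurs at least `k` times, so one of its occurrences has rank `k`.
    Q-wt : ∀ k → 1 ≤ k → wt lam mu Q k ≡ conjWt n lam mu T k
    Q-wt k 1≤k = trans (wt-class Q k) (≤-antisym
      (length≤bound (app T) (conjWt n lam mu T k) (class-unique Q k)
        (λ p → let x∈ = proj₁ (∈-class⁻ Q p) in
          T-pos x∈ , entry≤conjWt x∈ (≤-reflexive (sym (Q≡rank p))))
        (λ p q e → let (x∈ , ex) = ∈-class⁻ Q p ; (y∈ , ey) = ∈-class⁻ Q q in
          index-inj x∈ y∈ e (trans ex (sym ey))))
      (bound≤length (app T) (conjWt n lam mu T k) onto))
      where
      onto : ∀ {i} → 1 ≤ i → i ≤ conjWt n lam mu T k → ∃ λ x → x ∈ class Q k × app T x ≡ i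
      onto {i} 1≤i i≤ with pigeonhole rank k (class-unique T i)
        (λ p → rank-pos (proj₁ (∈-class⁻ T p)))
        (λ p q → let (y∈ , Ty) = ∈-class⁻ T p ; (z∈ , Tz) = ∈-class⁻ T q in
          class-inj y∈ z∈ (trans Ty (sym Tz)))
        1≤k (subst (k ≤_) (wt-class T i) (Conjugate.≤size⇒P k 1≤i i≤))
      ... | z , z∈ , k≤ with ∈-class⁻ T z∈
      ... | z∈c , Tz with rank-descend z∈c 1≤k k≤
      ... | x , x∈ , (Tx , _) , rx = x , ∈-class⁺ Q x∈ (trans (Q-rank x∈) rx) , trans Tx Tz

    -- If the length were `2p + 1`, then part `2p + 1` of the weight would be at least `k`. So would
    -- the equal part `2p + 2`, and the length would be at least `2p + 2`.
    conjWt-even : ∀ k → 2 ∣ conjWt n lam mu T k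
    conjWt-even k with even-or-odd (conjWt n lam mu T k)
    ... | p , inj₁ e = divides p (trans e (*-comm 2 p))
    ... | p , inj₂ e = contradiction (Conjugate.P⇒≤size k bound (subst (k ≤_) (proj₂ (proj₁ (proj₂ (proj₂ T∈LRS))) p)
        (Conjugate.≤size⇒P k (s≤s z≤n) (≤-reflexive (sym e)))))
      (<⇒≱ (s≤s (≤-reflexive e)))
      where
      -- `conjWt` only looks at entries up to `2 * n`; an odd number within this bound leaves room
      -- for its successor.
      bound : suc (suc (2 * p)) ≤ 2 * n
      bound = subst (_≤ 2 * n) (*-suc 2 p)
        (*-monoʳ-≤ 2 (*-cancelˡ-< 2 p n (subst (_≤ 2 * n) e (Conjugate.size≤N k))))

    -- Below row n the columns of the skew diagram are full columns of λ, and
    -- condition (iii) forbids 2p + 1 in row n + p + 1, so entries grow by two per row.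
    entry-lower : length mu ≤ n → ∀ p {j} → InSkew lam mu (n + p) j → 2 * p ≤ T (n + p) j
    entry-lower len≤n zero    s = z≤n
    entry-lower len≤n (suc p) {j} s = subst (_≤ T (n + suc p) j) (sym (*-suc 2 p)) (≤∧≢⇒< (odd p s)
      (λ e → <⇒≱ (+-monoʳ-< n (n<1+n p)) (proj₂ (proj₂ (proj₂ T∈LRS)) _ _ p s (sym e))))
      where
      odd : ∀ p → InSkew lam mu (n + suc p) j → 1 + 2 * p ≤ T (n + suc p) j
      odd zero    s = proj₁ (T-range (∈-cells⁺ s))
      odd (suc p) s = ≤-<-trans (entry-lower len≤n (suc p) above)
        (T-strict (∈-cells⁺ above) (∈-cells⁺ s) (+-monoʳ-< n (n<1+n (suc p))) ≤-refl)
        where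
        above : InSkew lam mu (n + suc p) j
        above = subst (_< j) (sym (part-beyond mu (≤-trans (s≤s len≤n) (m<m+n n (s≤s z≤n))))) (≤-<-trans z≤n (proj₁ s)) ,
          ≤-trans (proj₂ s) (part-antitone (≤-trans (s≤s z≤n) (m≤n+m (suc p) n)) (+-monoʳ-≤ n (n≤1+n (suc p))))

    -- When the maximum is `length mu`, the truncated difference vanishes. Otherwise a cell `c` with
    -- label at least `k` attains it: its entry is at least `2 * (row c ∸ n)`, and at most the
    -- number of entries occurring `k` times or more.
    lenAbove-bound : length mu ≤ n → ∀ k → 1 ≤ k → 2 * (lenAbove lam mu Q k ∸ n) ≤ wt lam mu Q k
    lenAbove-bound len≤n k 1≤k
      with foldr-⊔-sel (length mu) (map proj₁ (filter (λ c → k ≤? app Q c) cells))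
    ... | inj₁ e = subst (λ z → 2 * z ≤ wt lam mu Q k)
      (sym (m≤n⇒m∸n≡0 (subst (_≤ n) (sym e) len≤n))) z≤n
    ... | inj₂ p with ∈-map⁻ proj₁ p
    ... | c , c∈f , e with ∈-filter⁻ (λ c → k ≤? app Q c) {xs = cells} c∈f
    ... | c∈ , k≤ = ≤-trans (subst (λ l → 2 * (l ∸ n) ≤ app T c) (sym e) low)
      (≤-trans (entry≤conjWt c∈ (subst (k ≤_) (Q-rank c∈) k≤)) (≤-reflexive (sym (Q-wt k 1≤k))))
      where
      low : 2 * (row c ∸ n) ≤ app T c
      low with row c ≤? n
      ... | yes r≤n = subst (λ z → 2 * z ≤ app T c) (sym (m≤n⇒m∸n≡0 r≤n)) z≤n
      ... | no  r≰n = subst (λ r → 2 * (row c ∸ n) ≤ T r (col c)) eq (entry-lower len≤n (row c ∸ n)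
          (subst (λ r → InSkew lam mu r (col c)) (sym eq) (∈-cells⁻ c∈)))
        where
        eq : n + (row c ∸ n) ≡ row c
        eq = m+[n∸m]≡n (<⇒≤ (≰⇒> r≰n))

    -- Climb from `y` inside its strip to the entry `T x`. The cell reached has the label of `y` and
    -- lies strictly right of `x`, so it comes earlier among the cells with entry `T x`.
    Q-rows : ∀ {x y} → x ∈ cells → y ∈ cells → row x ≡ row y → col x < col y → app Q y < app Q x
    Q-rows {x} {y} x∈ y∈ r c
      with T-descend y∈ (T-pos x∈) (T-mono x∈ y∈ (≤-reflexive r) (<⇒≤ c))
    ... | e , e∈ , Te , Qe , _ , ce = subst (_< app Q x) Qe
      (subst (λ q → q < app Q x) (sym (Q-rank e∈)) (subst (rank e <_) (sym (Q-rank x∈))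
        (rank-strict x∈ (Te , <⇒≤ (<-≤-trans c ce)) (λ { (_ , c′) → <⇒≱ (<-≤-trans c ce) c′ }))))

    Q-columns : ∀ {x y} → x ∈ cells → y ∈ cells → row x ≤ row y → col x ≡ col y → app Q y ≤ app Q x
    Q-columns {x} {y} x∈ y∈ r c
      with T-descend y∈ (T-pos x∈) (T-mono x∈ y∈ r (≤-reflexive c))
    ... | e , e∈ , Te , Qe , _ , ce = subst (_≤ app Q x) Qe
      (subst (λ q → q ≤ app Q x) (sym (Q-rank e∈)) (subst (rank e ≤_) (sym (Q-rank x∈))
        (rank-mono {e} {x} (Te , ≤-trans (≤-reflexive c) ce))))

    -- `Q-pred` lowers the label by one, keeps the entry of `T` and does not go down. The entry
    -- identifies a cell among those of one label, so this is an injection.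
    Q-wtRows : ∀ r k → 1 ≤ k → wtRows lam mu Q r (suc k) ≤ wtRows lam mu Q r k
    Q-wtRows r (suc k) _ = length-injection (λ x y → app T x ≡ app T y)
      (Unique.filter⁺ (inRows? (suc (suc k))) cells-unique) to inj
      where
      inRows? : ∀ k c → Dec (row c ≤ r × k ≡ app Q c)
      inRows? k c = (row c ≤? r) ×-dec (k ≟ app Q c)

      to : ∀ {x} → x ∈ filter (inRows? (suc (suc k))) cells
        → ∃ λ y → y ∈ filter (inRows? (suc k)) cells × app T x ≡ app T y
      to p with ∈-filter⁻ (inRows? (suc (suc k))) {xs = cells} p
      ... | x∈ , x≤r , Qx with Q-pred x∈ (sym Qx)
      ...   | e , e∈ , Qe , Te , re , _ =
        e , ∈-filter⁺ (inRows? (suc k)) e∈ (≤-trans re x≤r , sym Qe) , sym Te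

      inj : ∀ {x x′ y} → x ∈ filter (inRows? (suc (suc k))) cells → x′ ∈ filter (inRows? (suc (suc k))) cells
        → app T x ≡ app T y → app T x′ ≡ app T y → x ≡ x′
      inj p q e e′ with ∈-filter⁻ (inRows? (suc (suc k))) {xs = cells} p | ∈-filter⁻ (inRows? (suc (suc k))) {xs = cells} q
      ... | x∈ , _ , Qx | x′∈ , _ , Qx′ = index-inj x∈ x′∈ (trans e (sym e′)) (trans (sym Qx) Qx′)

    Q-Rec : length mu ≤ n → Rec n lam mu Q
    Q-Rec len≤n =
        (λ i j s → Q-pos (∈-cells⁺ s))
      , (λ i j j′ s s′ → Q-rows (∈-cells⁺ s) (∈-cells⁺ s′) refl)
      , (λ i i′ j s s′ r → Q-columns (∈-cells⁺ s) (∈-cells⁺ s′) r refl)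
      , (λ k 1≤k → subst (2 ∣_) (sym (Q-wt k 1≤k)) (conjWt-even k))
      , lenAbove-bound len≤n
      , (λ r k _ → Q-wtRows r k)

-- Arithmetic for condition (iii) and for even weights

-- With `d = z ∸ (2m + 1)`, a row `a` beyond `n + m` forces `L ∸ n` to be at least `m + d + 1`. Its
-- double `2m + 2d + 2` then exceeds `z = 2m + 1 + d`.
row-bound : ∀ n m a z L → suc (2 * m) ≤ z → a + (z ∸ suc (2 * m)) ≤ L → 2 * (L ∸ n) ≤ z → a ≤ n + m
row-bound n m a z L t≤z a+d≤L L≤z = ≮⇒≥ λ nm<a → <⇒≱ (2z< nm<a) L≤z
  where
  d = z ∸ suc (2 * m)

  excess : n + m < a → suc (m + d) ≤ L ∸ n
  excess nm<a = begin
    suc (m + d)           ≡⟨ m+n∸m≡n n (suc (m + d)) ⟨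
    n + suc (m + d) ∸ n   ≡⟨ cong (_∸ n) (trans (+-suc n (m + d)) (cong suc (sym (+-assoc n m d)))) ⟩
    suc (n + m) + d ∸ n   ≤⟨ ∸-monoˡ-≤ n (+-monoˡ-≤ d nm<a) ⟩
    a + d ∸ n             ≤⟨ ∸-monoˡ-≤ n a+d≤L ⟩
    L ∸ n                 ∎
    where open ≤-Reasoning

  2z< : n + m < a → z < 2 * (L ∸ n)
  2z< nm<a = begin-strict
    z                         ≡⟨ m+[n∸m]≡n t≤z ⟨
    suc (2 * m) + d           ≤⟨ +-monoʳ-≤ (suc (2 * m)) (m≤m+n d (d + 0)) ⟩
    suc (2 * m) + 2 * d       ≡⟨ cong suc (*-distribˡ-+ 2 m d) ⟨
    suc (2 * (m + d))         <⟨ n<1+n _ ⟩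
    2 + 2 * (m + d)           ≡⟨ *-suc 2 (m + d) ⟨
    2 * suc (m + d)           ≤⟨ *-monoʳ-≤ 2 (excess nm<a) ⟩
    2 * (L ∸ n)               ∎
    where open ≤-Reasoning

even-bound : ∀ i {m} → 2 ∣ m → suc (2 * i) ≤ m → suc (suc (2 * i)) ≤ m
even-bound i (divides q eq) le = ≤∧≢⇒< le
  (λ e → even≢odd q i (trans (*-comm 2 q) (trans (sym eq) (sym e))))

-- Reconstructing the tableau from the recording tableau

module Recording (n : ℕ) (lam mu : List ℕ) (lam-desc : Linked (λ a b → b ≤ a) lam)
  (Q : Filling) (Q∈Rec : Rec n lam mu Q) where

  open Shape lam mu lam-desc

  Q-positive : ∀ {x} → x ∈ cells → 1 ≤ app Q x
  Q-positive x∈ = proj₁ Q∈Rec _ _ (∈-cells⁻ x∈)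

  Q-columns : ∀ i i′ j → InSkew lam mu i j → InSkew lam mu i′ j → i ≤ i′ → Q i′ j ≤ Q i j
  Q-columns = proj₁ (proj₂ (proj₂ Q∈Rec))

  Q-strict : ∀ {x y} → x ∈ cells → y ∈ cells → row x ≤ row y → col x < col y → app Q y < app Q x
  Q-strict x∈ y∈ r c = ≤-<-trans
    (Q-columns _ _ _ (corner x∈ y∈ r (<⇒≤ c)) (∈-cells⁻ y∈) r)
    (proj₁ (proj₂ Q∈Rec) _ _ _ (∈-cells⁻ x∈) (corner x∈ y∈ r (<⇒≤ c)) c)

  Q-anti : ∀ {x y} → x ∈ cells → y ∈ cells → row x ≤ row y → col x ≤ col y → app Q y ≤ app Q x
  Q-anti x∈ y∈ r c with m≤n⇒m<n∨m≡n c
  ... | inj₁ c<   = <⇒≤ (Q-strict x∈ y∈ r c<)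
  ... | inj₂ refl = Q-columns _ _ _ (∈-cells⁻ x∈) (∈-cells⁻ y∈) r

  distinct-rows : ∀ {x y} → x ∈ cells → y ∈ cells → app Q x ≡ app Q y → row x ≡ row y → x ≡ y
  distinct-rows {x} {y} x∈ y∈ e r with <-cmp (col x) (col y)
  ... | tri≈ _ c _ = cong₂ _,_ r c
  ... | tri< c _ _ = contradiction (sym e) (<⇒≢ (Q-strict x∈ y∈ (≤-reflexive r) c))
  ... | tri> _ _ c = contradiction e (<⇒≢ (Q-strict y∈ x∈ (≤-reflexive (sym r)) c))

  open ByRow Q distinct-rows

  inRows? : ∀ r k c → Dec (row c ≤ r × k ≡ app Q c)
  inRows? r k c = (row c ≤? r) ×-dec (k ≟ app Q c)

  ∈-rows⁻ : ∀ {r k x} → x ∈ filter (inRows? r k) cells → x ∈ cells × row x ≤ r × app Q x ≡ k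
  ∈-rows⁻ {r} {k} p = let (x∈ , x≤r , e) = ∈-filter⁻ (inRows? r k) {xs = cells} p in x∈ , x≤r , sym e

  -- The mirror image of `rank-T-pred`, with (R5) at the row of `x` in place of the Yamanouchi
  -- condition: `rank x` is itself the count of the label of `x` in these rows.
  rank-Q-pred : ∀ {x k} → x ∈ cells → app Q x ≡ suc (suc k) → ∃ λ e → e ∈ cells
    × app Q e ≡ suc k × rank e ≡ rank x × row e ≤ row x × col x < col e
  rank-Q-pred {x} {k} x∈ Qx with pigeonhole rank (rank x)
      (Unique.filter⁺ (inRows? (row x) (suc k)) cells-unique)
      (λ p → rank-pos (proj₁ (∈-rows⁻ p)))
      (λ p q → let (y∈ , _ , Qy) = ∈-rows⁻ p ; (z∈ , _ , Qz) = ∈-rows⁻ q in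
        class-inj y∈ z∈ (trans Qy (sym Qz)))
      (rank-pos x∈)
      (subst (λ q → wtRows lam mu Q (row x) q ≤ wtRows lam mu Q (row x) (suc k)) (sym Qx)
        (proj₂ (proj₂ (proj₂ (proj₂ (proj₂ Q∈Rec)))) (row x) (suc k) (1≤row (∈-cells⁻ x∈)) (s≤s z≤n)))
  ... | z , z∈r , rz with ∈-rows⁻ z∈r
  ... | z∈ , z≤x , Qz with rank-descend z∈ (rank-pos x∈) rz
  ... | e , e∈ , (e≤z , Qe) , re = e , e∈ , Qe′ , re , ≤-trans e≤z z≤x ,
    -- Were `e` weakly left of `x`, then, being weakly above it, it would carry a label at least
    -- that of `x`.
    ≰⇒> (λ c → <⇒≱ (≤-reflexive (trans (cong suc Qe′) (sym Qx))) (Q-anti e∈ x∈ (≤-trans e≤z z≤x) c))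
    where
    Qe′ : app Q e ≡ suc k
    Qe′ = trans (sym Qe) Qz

  rank-biranked : Biranked (λ i j → rank (i , j)) Q
  rank-biranked = record
    { T-pos = rank-pos
    ; Q-pos = Q-positive
    ; index-inj = λ x∈ y∈ e e′ → class-inj x∈ y∈ e′ e
    ; T-pred = λ {x} {t} x∈ rx → let (e , e∈ , (r , Qe) , re) = rank-pred x∈ rx in
        e , e∈ , re , sym Qe ,
        ≤∧≢⇒< r (λ r≡ → 1+n≢n (trans (sym rx) (trans (cong rank (sym (distinct-rows e∈ x∈ (sym Qe) r≡))) re))) ,
        ≮⇒≥ (λ c → <⇒≢ (Q-strict e∈ x∈ r c) Qe)
    ; Q-pred = rank-Q-pred
    }

  wtRows-antitone-by : ∀ r d k → 1 ≤ r → 1 ≤ k → wtRows lam mu Q r (d + k) ≤ wtRows lam mu Q r k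
  wtRows-antitone-by r zero    k _   _   = ≤-refl
  wtRows-antitone-by r (suc d) k 1≤r 1≤k = ≤-trans
    (proj₂ (proj₂ (proj₂ (proj₂ (proj₂ Q∈Rec)))) r (d + k) 1≤r (≤-trans 1≤k (m≤n+m k d)))
    (wtRows-antitone-by r d k 1≤r 1≤k)

  wtRows-antitone : ∀ r {k k′} → 1 ≤ r → 1 ≤ k → k ≤ k′ → wtRows lam mu Q r k′ ≤ wtRows lam mu Q r k
  wtRows-antitone r {k} {k′} 1≤r 1≤k k≤k′ = subst (λ l → wtRows lam mu Q r l ≤ wtRows lam mu Q r k)
    (m∸n+n≡m k≤k′) (wtRows-antitone-by r (k′ ∸ k) k 1≤r 1≤k)

  wtRows<rank : ∀ {r y} → y ∈ cells → r < row y → wtRows lam mu Q r (app Q y) < rank y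
  wtRows<rank {r} {y} y∈ r<y = length-injection _≡_ {xs = y ∷ filter (inRows? r (app Q y)) cells}
    (All.tabulate (λ z∈ → λ { refl → <⇒≱ r<y (proj₁ (proj₂ (∈-rows⁻ z∈))) })
      ∷ Unique.filter⁺ (inRows? r (app Q y)) cells-unique)
    (λ { (here refl) → y , ∈-below⁺ y∈ (≤-refl , refl) , refl
       ; {z} (there p) → let (z∈ , z≤r , Qz) = ∈-rows⁻ p in
           z , ∈-below⁺ z∈ (<⇒≤ (≤-<-trans z≤r r<y) , sym Qz) , refl })
    (λ _ _ e e′ → trans e (sym e′))

  rank≤wt : ∀ {x} → rank x ≤ wt lam mu Q (app Q x)
  rank≤wt {x} = subst (rank x ≤_) (sym (wt-class Q (app Q x))) (length-injection _≡_ (below-unique x)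
    (λ {z} p → let (z∈ , _ , e) = ∈-below⁻ p in z , ∈-class⁺ Q z∈ (sym e) , refl)
    (λ _ _ e e′ → trans e (sym e′)))

  rank≤length : ∀ {x} → rank x ≤ length lam
  rank≤length {x} = length≤bound row (length lam) (below-unique x)
    (λ p → let s = ∈-cells⁻ (proj₁ (∈-below⁻ p)) in 1≤row s , row≤length s)
    (λ p q r → let (y∈ , _ , Qy) = ∈-below⁻ p ; (z∈ , _ , Qz) = ∈-below⁻ q in
      distinct-rows y∈ z∈ (trans (sym Qy) Qz) r)

  large-rank : ∀ {k t} → 1 ≤ t → t ≤ wt lam mu Q k → ∃ λ z → z ∈ cells × app Q z ≡ k × t ≤ rank z
  large-rank {k} {t} 1≤t t≤ with pigeonhole rank t (class-unique Q k)
      (λ p → rank-pos (proj₁ (∈-class⁻ Q p)))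
      (λ p q → let (y∈ , Qy) = ∈-class⁻ Q p ; (z∈ , Qz) = ∈-class⁻ Q q in
        class-inj y∈ z∈ (trans Qy (sym Qz)))
      1≤t (subst (t ≤_) (wt-class Q k) t≤)
  ... | z , z∈ , t≤z = z , proj₁ (∈-class⁻ Q z∈) , proj₂ (∈-class⁻ Q z∈) , t≤z

  -- The defining conditions of the reconstructed tableau

  module Reconstructed (T : Filling) (T-rank : ∀ x → app T x ≡ rank x) (b : Biranked T Q) where

    open Biranked b

    T≤wt : ∀ x → app T x ≤ wt lam mu Q (app Q x)
    T≤wt x = ≤-trans (≤-reflexive (T-rank x)) (rank≤wt {x})

    large-entry : ∀ {k t} → 1 ≤ t → t ≤ wt lam mu Q k → ∃ λ z → z ∈ cells × app Q z ≡ k × t ≤ app T z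
    large-entry 1≤t t≤ = let (z , z∈ , Qz , t≤z) = large-rank 1≤t t≤ in
      z , z∈ , Qz , ≤-trans t≤z (≤-reflexive (sym (T-rank z)))

    -- Both entries count labels in rows up to `i`. The label to the right is smaller, and by (R5)
    -- smaller labels are at least as frequent there.
    T-rows : ∀ i j j′ → InSkew lam mu i j → InSkew lam mu i j′ → j ≤ j′ → T i j ≤ T i j′
    T-rows i j j′ s s′ j≤j′ = subst₂ _≤_ (sym (T-rank (i , j))) (sym (T-rank (i , j′))) (wtRows-antitone i (1≤row s) (Q-positive (∈-cells⁺ s′))
      (Q-anti (∈-cells⁺ s) (∈-cells⁺ s′) ≤-refl j≤j′))

    T-columns : ∀ i i′ j → InSkew lam mu i j → InSkew lam mu i′ j → i < i′ → T i j < T i′ j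
    T-columns i i′ j s s′ i<i′ = subst₂ _<_ (sym (T-rank (i , j))) (sym (T-rank (i′ , j))) (≤-<-trans
      (wtRows-antitone i (1≤row s) (Q-positive (∈-cells⁺ s′)) (Q-columns i i′ j s s′ (<⇒≤ i<i′)))
      (wtRows<rank (∈-cells⁺ s′) i<i′))

    -- `T-pred` sends an entry `t + 2` to an earlier entry `t + 1` with the same label, hence within
    -- the same prefix; the label makes this injective.
    T-yamanouchi : Yamanouchi (word lam mu T)
    T-yamanouchi m t = ≤-trans (≤-reflexive (count-prefix T (suc (suc t)) m))
      (≤-trans (length-injection (λ x y → app Q x ≡ app Q y) (Unique.filter⁺ (entry? (suc (suc t))) (Unique.take⁺ m cells-unique)) to inj)
        (≤-reflexive (sym (count-prefix T (suc t) m))))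
      where
      entry? : ∀ k c → Dec (k ≡ app T c)
      entry? k c = k ≟ app T c

      prefix : ℕ → List Cell
      prefix k = filter (entry? k) (take m cells)

      to : ∀ {x} → x ∈ prefix (suc (suc t)) → ∃ λ y → y ∈ prefix (suc t) × app Q x ≡ app Q y
      to {x} p with ∈-filter⁻ (entry? (suc (suc t))) {xs = take m cells} p
      ... | x∈ , Tx with T-pred (∈-take m x∈) (sym Tx)
      ... | e , e∈ , Te , Qe , r , c = e ,
        ∈-filter⁺ (entry? (suc t)) (take-closed ≺ᴿ-asym m cells-sorted x∈ e∈ (before (m≤n⇒m<n∨m≡n c))) (sym Te) , sym Qe
        where
        before : col x < col e ⊎ col x ≡ col e → e ≺ᴿ x
        before (inj₁ c<) = inj₁ c<
        before (inj₂ c≡) = inj₂ (sym c≡ , r)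

      inj : ∀ {x x′ y} → x ∈ prefix (suc (suc t)) → x′ ∈ prefix (suc (suc t))
        → app Q x ≡ app Q y → app Q x′ ≡ app Q y → x ≡ x′
      inj p q e e′ with ∈-filter⁻ (entry? (suc (suc t))) {xs = take m cells} p
                      | ∈-filter⁻ (entry? (suc (suc t))) {xs = take m cells} q
      ... | x∈ , Tx | x′∈ , Tx′ = index-inj (∈-take m x∈) (∈-take m x′∈) (trans (sym Tx) Tx′) (trans e (sym e′))

    T-wt-pred : ∀ k → wt lam mu T (suc (suc k)) ≤ wt lam mu T (suc k)
    T-wt-pred k = subst (λ w → count (suc (suc k)) w ≤ count (suc k) w)
      (take-all (length (word lam mu T)) (word lam mu T) ≤-refl) (T-yamanouchi (length (word lam mu T)) k)

    -- By (R3) each label occurs an even number of times, so a strip that reaches the entry `2i + 1`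
    -- also reaches `2i + 2`. Matching the two by their label gives the inequality that the
    -- Yamanouchi condition does not.
    T-wt-even : ∀ i → wt lam mu T (suc (2 * i)) ≡ wt lam mu T (suc (suc (2 * i)))
    T-wt-even i = ≤-antisym
      (≤-trans (≤-reflexive (wt-class T (suc (2 * i))))
        (≤-trans (length-injection (λ x y → app Q x ≡ app Q y) (class-unique T (suc (2 * i))) to inj)
          (≤-reflexive (sym (wt-class T (suc (suc (2 * i))))))))
      (T-wt-pred (2 * i))
      where
      to : ∀ {x} → x ∈ class T (suc (2 * i)) → ∃ λ y → y ∈ class T (suc (suc (2 * i))) × app Q x ≡ app Q y
      to {x} p =
        let (x∈ , Tx) = ∈-class⁻ T p
            (z , z∈ , Qz , t≤z) = large-entry (s≤s z≤n)
              (even-bound i (proj₁ (proj₂ (proj₂ (proj₂ Q∈Rec))) (app Q x) (Q-positive x∈))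
                (subst (_≤ wt lam mu Q (app Q x)) Tx (T≤wt x)))
            (e , e∈ , Te , Qe , _) = T-descend z∈ (s≤s z≤n) t≤z
        in e , ∈-class⁺ T e∈ Te , sym (trans Qe Qz)

      inj : ∀ {x x′ y} → x ∈ class T (suc (2 * i)) → x′ ∈ class T (suc (2 * i))
        → app Q x ≡ app Q y → app Q x′ ≡ app Q y → x ≡ x′
      inj p q e e′ = let (x∈ , Tx) = ∈-class⁻ T p ; (x′∈ , Tx′) = ∈-class⁻ T q in
        index-inj x∈ x′∈ (trans Tx (sym Tx′)) (trans e (sym e′))

    -- The last cell z of the strip of x lies at least T z − T x rows below x and
    -- within the first ℓ rows, where 2 (ℓ − n) ≤ T z by (R4).
    T-odd : ∀ {x} m → x ∈ cells → app T x ≡ suc (2 * m) → row x ≤ n + m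
    T-odd {x} m x∈ Tx =
      let (z , z∈ , Qz , W≤z) = large-entry (≤-trans (T-pos x∈) (T≤wt x)) ≤-refl
          (e , e∈ , Te , Qe , re , _) = T-descend z∈ (T-pos x∈) (≤-trans (T≤wt x) W≤z)
          e≡x = index-inj e∈ x∈ Te (trans Qe Qz)
      in row-bound n m (row x) (app T z) (lenAbove lam mu Q (app Q x))
        (subst (_≤ app T z) Tx (≤-trans (T≤wt x) W≤z))
        (≤-trans (subst₂ (λ c t → row c + (app T z ∸ t) ≤ row z) e≡x Tx re)
          (foldr-⊔-upper (length mu) (∈-map⁺ proj₁
            (∈-filter⁺ (λ c → app Q x ≤? app Q c) z∈ (≤-reflexive (sym Qz))))))
        (≤-trans (proj₁ (proj₂ (proj₂ (proj₂ (proj₂ Q∈Rec)))) (app Q x) (Q-positive x∈)) W≤z)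

    T∈LRS : length lam ≤ 2 * n → LRS n lam mu T
    T∈LRS len≤2n =
        ( (λ i j s → T-pos (∈-cells⁺ s) , ≤-trans (≤-reflexive (T-rank (i , j))) (≤-trans (rank≤length {i , j}) len≤2n))
        , T-rows , T-columns )
      , T-yamanouchi
      , (T-wt-pred , T-wt-even)
      , (λ i j k s → T-odd k (∈-cells⁺ s))

-- Well-definedness, injectivity and surjectivity of the relabelling

theoremA : (n : ℕ) → 1 ≤ n → (lam mu : List ℕ)
    → IsPartition lam → length lam ≤ 2 * n
    → IsPartition mu → length mu ≤ n
    → mu ⊆P lam
    → ((T : Filling) → LRS n lam mu T
    → Rec n lam mu (diamond n lam mu T)
    × ((k : ℕ) → 1 ≤ k → wt lam mu (diamond n lam mu T) k ≡ conjWt n lam mu T k))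
    × ((T T' : Filling) → LRS n lam mu T → LRS n lam mu T'
    → diamond n lam mu T ≈[ lam / mu ] diamond n lam mu T'
    → T ≈[ lam / mu ] T')
    × ((Q : Filling) → Rec n lam mu Q
    → Σ Filling (λ T → LRS n lam mu T × (diamond n lam mu T ≈[ lam / mu ] Q)))
theoremA n _ lam mu (_ , lam-desc) len-lam _ len-mu _ = into , injective , onto
  where
  open Shape lam mu lam-desc

  into : (T : Filling) → LRS n lam mu T
    → Rec n lam mu (diamond n lam mu T)
    × ((k : ℕ) → 1 ≤ k → wt lam mu (diamond n lam mu T) k ≡ conjWt n lam mu T k)
  into T T∈LRS = Relabelled.Q-Rec _ diamond-rank biranked len-mu , Relabelled.Q-wt _ diamond-rank biranked
    where open Tableau n lam mu lam-desc T T∈LRS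

  injective : (T T' : Filling) → LRS n lam mu T → LRS n lam mu T'
    → diamond n lam mu T ≈[ lam / mu ] diamond n lam mu T' → T ≈[ lam / mu ] T'
  injective T T' T∈ T'∈ eq i j s = trans
    (sym (biranked⇒T (Tableau.biranked n lam mu lam-desc T T∈) distinct (∈-cells⁺ s)))
    (biranked⇒T (biranked-resp (λ i j s → sym (eq i j s)) (Tableau.biranked n lam mu lam-desc T' T'∈)) distinct (∈-cells⁺ s))
    where
    distinct = Recording.distinct-rows n lam mu lam-desc (diamond n lam mu T) (proj₁ (into T T∈))

  onto : (Q : Filling) → Rec n lam mu Q
    → Σ Filling (λ T → LRS n lam mu T × (diamond n lam mu T ≈[ lam / mu ] Q))
  -- The preimage numbers the cells of each label of `Q` from top to bottom. Its relabelling is the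
  -- rank from the right among equal entries, which `biranked⇒Q` identifies with `Q`.
  onto Q Q∈Rec = (λ i j → rank (i , j)) , T∈LRS len-lam , λ i j s → trans
    (Tableau.diamond-rank n lam mu lam-desc _ (T∈LRS len-lam) (∈-cells⁺ s))
    (biranked⇒Q rank-biranked (Tableau.distinct-columns n lam mu lam-desc _ (T∈LRS len-lam)) (∈-cells⁺ s))
    where
    open Recording n lam mu lam-desc Q Q∈Rec
    open ByRow Q distinct-rows using (rank)
    open Reconstructed (λ i j → rank (i , j)) (λ _ → refl) rank-biranked using (T∈LRS)
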